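{- Let $\overline{p}(n)$ denote the number of overpartitions of $n$, and for integers $c\geq 3$ and any residue $a$ modulo $c$ let $\overline{N}(a,c,n)$ denote the number of overpartitions of $n$ whose rank is congruent to $a$ modulo $c$. Then \begin{align*} &0.0019\,\overline{p}(n)<\overline{N}(a,3,n)<0.6648\,\overline{p}(n)\quad\text{for } n\geq 2089,\\ &0.0091\,\overline{p}(n)<\overline{N}(a,4,n)<0.4909\,\overline{p}(n)\quad\text{for } n\geq 272,\\ &0.0103\,\overline{p}(n)<\overline{N}(a,5,n)<0.3897\,\overline{p}(n)\quad\text{for } n\geq 449. \end{align*} Moreover, for every integer $c\geq 6$, defining \[ M_c:=1.691\times 10^{13}\,c^{20}\exp\left(\frac{16c^2(2c^2+\pi)}{\pi^2}\right), \] we have \[ \frac{1}{2c}\,\overline{p}(n)<\overline{N}(a,c,n)<\frac{3}{2c}\,\overline{p}(n)\quad\text{for all } n\geq M_c. \]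
   Context: An overpartition of a nonnegative integer $n$ is a partition of $n$ in which the first occurrence of each distinct part may be overlined. The rank of an overpartition $\lambda$ is its largest part minus its number of parts. -}

module Defs where

open import Data.Bool using (Bool; true; false)
open import Data.Bool.Properties using () renaming (_≟_ to _≟ᵇ_)
open import Data.Nat as ℕ using (ℕ; zero; suc; _+_; _*_; _∸_; _^_; _⊔_; _≤_; _<_; NonZero)
open import Data.Nat.Properties as ℕP using (_!≢0)
open import Data.Nat using (_!)
open import Data.Nat.ListAction using (sum)
import Data.Nat.Divisibility as ℕD
open import Data.Integer as ℤ using (ℤ; +_)
open import Data.Integer.Divisibility as ℤD using ()
open import Data.Rational.Unnormalised as ℚ using (ℚᵘ; 0ℚᵘ; 1ℚᵘ)
open import Data.List using (List; []; _∷_; length; map; foldr; filter; upTo; applyUpTo; cartesianProduct; concatMap)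
open import Data.List.Relation.Unary.All using (All; all?)
open import Data.List.Relation.Unary.Linked using (Linked; linked?)
open import Data.Product using (_×_; _,_; proj₁; proj₂)
open import Data.Sum using (_⊎_)
open import Relation.Binary.PropositionalEquality using (_≡_)
open import Relation.Nullary using (Dec; yes; no)
open import Relation.Nullary.Decidable using (_×-dec_; _⊎-dec_)
open import Relation.Unary using (Decidable)

-- Overpartitions
--
-- An overpartition is encoded as a list of (part , overlined?) pairs,
-- written in the canonical order: parts weakly decreasing, and among
-- equal parts the (at most one) overlined copy -- the "first occurrence"
-- -- comes first.  Thus between consecutive entries (p , b) (q , b′)
-- either q < p, or q ≡ p and the later copy b′ is not overlined.
-- Every overpartition has exactly one such encoding.

Entry : Set
Entry = ℕ × Bool

Next : Entry → Entry → Set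
Next (p , _) (q , b′) = (q < p) ⊎ ((q ≡ p) × (b′ ≡ false))

parts : List Entry → List ℕ
parts = map proj₁

IsOverpartitionOf : ℕ → List Entry → Set
IsOverpartitionOf n λs =
  All (λ e → 1 ≤ proj₁ e) λs × Linked Next λs × sum (parts λs) ≡ n

largestPart : List Entry → ℕ
largestPart λs = foldr _⊔_ 0 (parts λs)

numberOfParts : List Entry → ℕ
numberOfParts = length

rank : List Entry → ℤ
rank λs = + largestPart λs ℤ.- + numberOfParts λs

RankCong : ℤ → ℕ → List Entry → Set
RankCong a c λs = (+ c) ℤD.∣ (rank λs ℤ.- a)

next? : (x y : Entry) → Dec (Next x y)
next? (p , _) (q , b′) = (q ℕ.<? p) ⊎-dec ((q ℕ.≟ p) ×-dec (b′ ≟ᵇ false))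

isOverpartitionOf? : (n : ℕ) → Decidable (IsOverpartitionOf n)
isOverpartitionOf? n λs =
  all? (λ e → 1 ℕ.≤? proj₁ e) λs ×-dec linked? next? λs ×-dec (sum (parts λs) ℕ.≟ n)

rankCong? : (a : ℤ) (c : ℕ) → Decidable (RankCong a c)
rankCong? a c λs = ℤ.∣ + c ∣ ℕD.∣? ℤ.∣ rank λs ℤ.- a ∣

-- Finite search space: all lists of length ≤ n with entries in
-- {1,…,n} × Bool.  Every overpartition of n lies in it (parts are
-- positive and sum to n), and its members are pairwise distinct.
listsOfLength : {A : Set} → List A → ℕ → List (List A)
listsOfLength xs zero = [] ∷ []
listsOfLength xs (suc l) = concatMap (λ x → map (x ∷_) (listsOfLength xs l)) xs

candidates : ℕ → List (List Entry)
candidates n =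
  concatMap (listsOfLength (cartesianProduct (applyUpTo suc n) (true ∷ false ∷ [])))
            (upTo (suc n))

pbar : ℕ → ℕ
pbar n = length (filter (isOverpartitionOf? n) (candidates n))

Nbar : ℤ → ℕ → ℕ → ℕ
Nbar a c n =
  length (filter (λ λs → isOverpartitionOf? n λs ×-dec rankCong? a c λs) (candidates n))

-- The threshold  M_c = 1.691·10^13 · c^20 · exp(16c²(2c²+π)/π²).
--
-- There are no reals in the library, so "n ≥ M_c" is expressed as
-- "n ≥ L c k for every k", where (L c k)_k is an increasing sequence of
-- rationals with supremum exactly M_c.
--
-- π: with t_j = j!/(2j+1)!!, π/2 = Σ_{j≥0} t_j and t_{j+1} < t_j/2, so
--   U_k = 2 Σ_{j<k} t_j + 4 t_k  satisfies  U_k > π, U_k ↓ π.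
-- oddProd m l = (2m+1)(2m+3)⋯(2(m+l)−1); (2k+1)!! = oddProd 0 (suc k).

oddProd : ℕ → ℕ → ℕ
oddProd m zero = 1
oddProd m (suc l) = suc (2 * m) * oddProd (suc m) l

-- U_k = piUpperNum k / piUpperDen k   (common denominator (2k+1)!!)
piUpperNum : ℕ → ℕ
piUpperNum k = 4 * (k !) + 2 * sum (map (λ j → (j !) * oddProd (suc j) (k ∸ j)) (upTo k))

piUpperDen : ℕ → ℕ
piUpperDen k = oddProd 0 (suc k)

piUpperNum-nonZero : ∀ k → NonZero (piUpperNum k)
piUpperNum-nonZero k = ℕ.>-nonZero (ℕP.<-≤-trans (ℕ.>-nonZero⁻¹ (4 * (k !)) {{ℕP.m*n≢0 4 (k !) {{_}} {{k !≢0}}}}) (ℕP.m≤m+n (4 * (k !)) _))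

-- lower bound for the exponent 16c²(2c²+π)/π², obtained by replacing π
-- by U_k = P/Q:  16c²(2c²+P/Q)/(P/Q)² = 16c²(2c²Q² + PQ)/P².
exponentLower : ℕ → ℕ → ℚᵘ
exponentLower c k =
  (+ (16 * c ^ 2 * (2 * c ^ 2 * Q ^ 2 + P * Q))) ℚ./ (P * P)
  where
    P = piUpperNum k
    Q = piUpperDen k
    instance
      _ = ℕP.m*n≢0 P P {{piUpperNum-nonZero k}} {{piUpperNum-nonZero k}}

powᵘ : ℚᵘ → ℕ → ℚᵘ
powᵘ x zero = 1ℚᵘ
powᵘ x (suc j) = x ℚ.* powᵘ x j

expPartial : ℚᵘ → ℕ → ℚᵘ
expPartial x k =
  foldr ℚ._+_ 0ℚᵘ (map (λ j → powᵘ x j ℚ.* ((+ 1) ℚ./ (j !)) {{j !≢0}}) (upTo k))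

-- L c k ≤ M_c, increasing in k, with supremum M_c
McLower : ℕ → ℕ → ℚᵘ
McLower c k = ((+ (1691 * 10 ^ 10 * c ^ 20)) ℚ./ 1) ℚ.* expPartial (exponentLower c k) k

AtLeastMc : ℕ → ℕ → Set
AtLeastMc c n = ∀ k → McLower c k ℚ.≤ ((+ n) ℚ./ 1)

{-# OPTIONS --safe #-}
-- Trading two non-overlined parts 1 for one non-overlined part 2 lowers the number of parts by one. As soon as there is
-- a part ≥ 3 it fixes the largest part, so these trades arrange the overpartitions of n in chains of consecutive ranks,
-- and each chain is equidistributed modulo c up to an error less than 1. Hence N̄(a,c,n) differs from p̄(n)/c by at most
-- the number of chains, which is p̄(n) − p̄(n−2) + O(n).
--
-- For c ≤ 5 one needs p̄(n) − p̄(n−2) ≤ 0.236 p̄(n) for n ≥ 272. Logarithmic differentiation of the generating function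
-- gives n p̄(n) = Σ_k σ(k) p̄(n−k) with 2k ≤ σ(k) ≤ k(k+1). Subtracting the recurrences for n and n−2 propagates the
-- inequality, starting from a computed range 123 ≤ n ≤ 271: the contribution of the n < 123 where it may fail is
-- outweighed by 2p̄(n−2).
--
-- For c ≥ 6 the argument of Bateman and Erdős applies. An overpartition without a non-overlined 2 in which D distinct
-- part sizes occur has D ways of losing all of one size; this gives D (p̄(n) − p̄(n−2)) ≤ 4 p̄(n), up to the polynomially
-- many overpartitions with fewer than D part sizes. As p̄ grows superpolynomially, n ≥ (4c)^20 suffices.
module Submission where

open import Defs
open import Data.Bool using (Bool; true; false; T; _∧_; if_then_else_)
open import Data.Bool.Properties using (T-∧)
open import Data.Empty using (⊥; ⊥-elim)
open import Data.Integer as ℤ using (ℤ; 0ℤ; 1ℤ)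
import Data.Integer.DivMod as ℤ/
import Data.Integer.Divisibility.Signed as ℤ∣
import Data.Integer.Properties as ℤP
import Data.Integer.Tactic.RingSolver as ℤSolver
open import Data.List using (List; []; _∷_; [_]; _++_; map; length; filter; concat; replicate; foldr; drop; upTo; applyUpTo; applyDownFrom; cartesianProduct)
open import Data.List.Membership.Propositional using (_∈_; find; lose)
open import Data.List.Membership.Propositional.Properties
open import Data.List.Membership.Propositional.Properties.WithK using (unique∧set⇒bag)
open import Data.List.Properties using (length-++; length-map; filter-accept; filter-reject; filter-++; concat-++; concat-map; concat-map-[_]; ++-assoc; map-++; ∷-injectiveʳ)
open import Data.List.Relation.Binary.BagAndSetEquality using (∼bag⇒↭)
open import Data.List.Relation.Binary.Permutation.Propositional using (_↭_; ↭-refl; ↭-reflexive; ↭-trans; prep; swap; module PermutationReasoning)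
import Data.List.Relation.Binary.Permutation.Propositional.Properties as ↭
open import Data.List.Relation.Unary.All as All using (All; []; _∷_)
import Data.List.Relation.Unary.All.Properties as All
import Data.List.Relation.Unary.AllPairs as AllPairs
open AllPairs using ([]; _∷_)
import Data.List.Relation.Unary.AllPairs.Properties as AllPairs
open import Data.List.Relation.Unary.Any using (here; there)
open import Data.List.Relation.Unary.Linked as Linked using (Linked; []; [-]; _∷_)
import Data.List.Relation.Unary.Linked.Properties as Linked
open import Data.List.Relation.Unary.Unique.Propositional using (Unique)
import Data.List.Relation.Unary.Unique.Propositional.Properties as Unique
open import Data.Nat
open import Data.Nat.DivMod using (_%_; m*n/n≡m; m<n⇒m%n≡m; [m+n]%n≡m%n)
import Data.Nat.Divisibility as ℕ∣
open import Data.Nat.Induction using (<-rec)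
open import Data.Nat.ListAction using (sum)
open import Data.Nat.Properties
open import Data.Nat.Tactic.RingSolver using (solve-∀)
open import Data.Product using (_×_; _,_; proj₁; proj₂; ∃-syntax)
open import Data.Rational.Unnormalised as ℚ using (*≤*)
open import Data.Sum using (inj₁; inj₂)
open import Data.Unit using (tt)
open import Function using (_∘_; id; mk⇔; Equivalence)
open import Relation.Binary.PropositionalEquality hiding ([_])
open import Relation.Nullary using (yes; no)
open import Relation.Nullary.Decidable using (_×-dec_)

-- Coefficient sequences

-- The constant 0.236 is dictated by c = 5: an error below one per chain, in total at most 4/5 of
-- the number of chains, stays within 0.1897 p̄(n) of p̄(n)/5 only if there are fewer than 0.237125
-- p̄(n) chains. Of this, 0.001 p̄(n) is reserved for the O(n) overpartitions whose parts are all at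
-- most 2. Generating functions are handled without division. A series is characterised by an
-- equation g = u + q^m g with m ≥ 1, which has exactly one solution, and two series are identified
-- by exhibiting one such equation for both. The same recursion, run on lists instead of numbers,
-- enumerates the objects and groups them into chains, so that counts are lengths by construction.
-- The slow growth of p̄ alone does not propagate: the values below 123 enter the recurrence with
-- quadratic weights, so p̄ must also be kept above a quadratic. That lower bound is in turn deduced
-- from slow growth, and the two are proved together.

infix 4 _≐_
_≐_ : {A : Set} → (ℕ → A) → (ℕ → A) → Set
f ≐ g = ∀ n → f n ≡ g n

-- Multiplication by q^m on coefficient sequences.
shift : {A : Set} → A → ℕ → (ℕ → A) → ℕ → A
shift z zero f n = f n
shift z (suc m) f zero = z
shift z (suc m) f (suc n) = shift z m f n

shift-hom : {A B : Set} (h : A → B) (z : A) (m : ℕ) (f : ℕ → A) (n : ℕ) →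
  h (shift z m f n) ≡ shift (h z) m (h ∘ f) n
shift-hom h z zero f n = refl
shift-hom h z (suc m) f zero = refl
shift-hom h z (suc m) f (suc n) = shift-hom h z m f n

shift-rel₀ : {A B : Set} (_~_ : A → B → Set) {x : A} {y : B} → x ~ y → (m : ℕ) {f : ℕ → A} {g : ℕ → B} (n : ℕ) →
  (∀ k → k ≤ n → f k ~ g k) → shift x m f n ~ shift y m g n
shift-rel₀ _~_ p zero n h = h n ≤-refl
shift-rel₀ _~_ p (suc m) zero h = p
shift-rel₀ _~_ p (suc m) (suc n) h = shift-rel₀ _~_ p m n (λ k k≤n → h k (m≤n⇒m≤1+n k≤n))

-- A shift by at least one reads only strictly smaller indices. This is what lets well-founded
-- induction pass through an equation g = f ⊕ φ (q^m g).
shift-rel : {A B : Set} (_~_ : A → B → Set) {x : A} {y : B} → x ~ y → (m : ℕ) {f : ℕ → A} {g : ℕ → B} (n : ℕ) →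
  (∀ k → k < n → f k ~ g k) → shift x (suc m) f n ~ shift y (suc m) g n
shift-rel _~_ p m zero h = p
shift-rel _~_ p m (suc n) h = shift-rel₀ _~_ p m n (λ k k≤n → h k (s≤s k≤n))

shift-cong : {A : Set} (z : A) (m : ℕ) {f g : ℕ → A} → f ≐ g → shift z m f ≐ shift z m g
shift-cong z m e n = shift-rel₀ _≡_ refl m n (λ k _ → e k)

shift-+ : {A : Set} (z : A) (k m : ℕ) (f : ℕ → A) → shift z k (shift z m f) ≐ shift z (k + m) f
shift-+ z zero m f n = refl
shift-+ z (suc k) m f zero = refl
shift-+ z (suc k) m f (suc n) = shift-+ z k m f n

shift-comm : {A : Set} (z : A) (k m : ℕ) (f : ℕ → A) → shift z k (shift z m f) ≐ shift z m (shift z k f)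
shift-comm z k m f n = trans (shift-+ z k m f n)
  (trans (cong (λ j → shift z j f n) (+-comm k m)) (sym (shift-+ z m k f n)))

shift-< : {A : Set} (z : A) {m n : ℕ} (f : ℕ → A) → n < m → shift z m f n ≡ z
shift-< z {suc m} {zero} f p = refl
shift-< z {suc m} {suc n} f (s≤s p) = shift-< z f p

shift-≥ : {A : Set} (z : A) (m n : ℕ) (f : ℕ → A) → shift z m f (m + n) ≡ f n
shift-≥ z zero n f = refl
shift-≥ z (suc m) n f = shift-≥ z m n f

-- The solution g of g = f ⊕ φ (q^m g), for m ≥ 1; the argument t is fuel.
unfold-fuel : {A : Set} → (A → A → A) → A → (A → A) → ℕ → ℕ → (ℕ → A) → ℕ → A
unfold-fuel _⊕_ z φ zero m f n = z
unfold-fuel _⊕_ z φ (suc t) m f n = f n ⊕ φ (shift z m (unfold-fuel _⊕_ z φ t m f) n)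

unfold : {A : Set} → (A → A → A) → A → (A → A) → ℕ → (ℕ → A) → ℕ → A
unfold _⊕_ z φ m f n = unfold-fuel _⊕_ z φ (suc n) m f n

unfold-fuel-irrelevant : {A : Set} (_⊕_ : A → A → A) (z : A) (φ : A → A) (m : ℕ) (f : ℕ → A) (t u n : ℕ) → n < t → n < u →
  unfold-fuel _⊕_ z φ t (suc m) f n ≡ unfold-fuel _⊕_ z φ u (suc m) f n
unfold-fuel-irrelevant _⊕_ z φ m f (suc t) (suc u) n (s≤s p) (s≤s q) =
  cong (λ x → f n ⊕ φ x) (shift-rel _≡_ refl m n
    (λ k k<n → unfold-fuel-irrelevant _⊕_ z φ m f t u k (<-≤-trans k<n p) (<-≤-trans k<n q)))

unfold-eq : {A : Set} (_⊕_ : A → A → A) (z : A) (φ : A → A) (m : ℕ) (f : ℕ → A) →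
  unfold _⊕_ z φ (suc m) f ≐ λ n → f n ⊕ φ (shift z (suc m) (unfold _⊕_ z φ (suc m) f) n)
unfold-eq _⊕_ z φ m f n = cong (λ x → f n ⊕ φ x) (shift-rel _≡_ refl m n
  (λ k k<n → unfold-fuel-irrelevant _⊕_ z φ m f n (suc k) k k<n ≤-refl))

-- Used with `length` and with `concat`, it turns an enumeration into its counting series and a list
-- of chains into the list of their members.
unfold-hom : {A B : Set} {_⊕_ : A → A → A} {z : A} {φ : A → A} {_⊕′_ : B → B → B} {φ′ : B → B} (h : A → B) →
  (∀ x y → h (x ⊕ y) ≡ h x ⊕′ h y) → (∀ x → h (φ x) ≡ φ′ (h x)) → (m : ℕ) (f : ℕ → A) →
  h ∘ unfold _⊕_ z φ m f ≐ unfold _⊕′_ (h z) φ′ m (h ∘ f)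
unfold-hom {_⊕_ = _⊕_} {z} {φ} {_⊕′_} {φ′} h h⊕ hφ m f n = go (suc n) n
  where
  go : ∀ t k → h (unfold-fuel _⊕_ z φ t m f k) ≡ unfold-fuel _⊕′_ (h z) φ′ t m (h ∘ f) k
  go zero k = refl
  go (suc t) k = trans (h⊕ _ _) (cong (h (f k) ⊕′_) (trans (hφ _) (cong φ′
    (trans (shift-hom h z m _ k) (shift-cong (h z) m (go t) k)))))

-- Multiplication by (1 + q^m) / (1 - q^m).
sh : ℕ → (ℕ → ℕ) → ℕ → ℕ
sh = shift 0

geo : ℕ → (ℕ → ℕ) → ℕ → ℕ
geo = unfold _+_ 0 id

step : ℕ → (ℕ → ℕ) → ℕ → ℕ
step m f n = geo m f n + sh m (geo m f) n

infixl 6 _∔_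
_∔_ : (ℕ → ℕ) → (ℕ → ℕ) → ℕ → ℕ
(f ∔ g) n = f n + g n

sh-∔ : ∀ m f g → sh m (f ∔ g) ≐ sh m f ∔ sh m g
sh-∔ zero f g n = refl
sh-∔ (suc m) f g zero = refl
sh-∔ (suc m) f g (suc n) = sh-∔ m f g n

sh-* : ∀ m c f n → sh m (λ k → c * f k) n ≡ c * sh m f n
sh-* m c f n = trans (cong (λ z → shift z m (λ k → c * f k) n) (sym (*-zeroʳ c))) (sym (shift-hom (c *_) 0 m f n))

-- This replaces division by 1 - q^(m+1).
sh-unique : ∀ m {u g h : ℕ → ℕ} → g ≐ u ∔ sh (suc m) g → h ≐ u ∔ sh (suc m) h → g ≐ h
sh-unique m {u} {g} {h} eg eh = <-rec _ λ n rec → trans (eg n)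
  (trans (cong (u n +_) (shift-rel _≡_ refl m n (λ k → rec {k}))) (sym (eh n)))

geo-eq : ∀ m f → geo (suc m) f ≐ f ∔ sh (suc m) (geo (suc m) f)
geo-eq = unfold-eq _+_ 0 id

step-eq : ∀ m f → step (suc m) f ≐ f ∔ sh (suc m) f ∔ sh (suc m) (step (suc m) f)
step-eq m f n = begin
  G n + sh s G n                                     ≡⟨ cong₂ _+_ (geo-eq m f n) (shift-cong 0 s (geo-eq m f) n) ⟩
  f n + sh s G n + sh s (f ∔ sh s G) n               ≡⟨ cong (f n + sh s G n +_) (sh-∔ s f (sh s G) n) ⟩
  f n + sh s G n + (sh s f n + sh s (sh s G) n)      ≡⟨ lemma (f n) (sh s G n) (sh s f n) _ ⟩
  f n + sh s f n + (sh s G n + sh s (sh s G) n)      ≡⟨ cong (f n + sh s f n +_) (sym (sh-∔ s G (sh s G) n)) ⟩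
  f n + sh s f n + sh s (G ∔ sh s G) n               ∎
  where
  open ≡-Reasoning
  s = suc m
  G = geo s f
  lemma : ∀ a b c d → a + b + (c + d) ≡ a + c + (b + d)
  lemma = solve-∀

step-unique : ∀ m {f g} → g ≐ f ∔ sh (suc m) f ∔ sh (suc m) g → g ≐ step (suc m) f
step-unique m {f} e = sh-unique m e (step-eq m f)

step-cong : ∀ m {f g} → f ≐ g → step (suc m) f ≐ step (suc m) g
step-cong m {f} {g} e = step-unique m λ n → trans (step-eq m f n)
  (cong (_+ sh (suc m) (step (suc m) f) n) (cong₂ _+_ (e n) (shift-cong 0 (suc m) e n)))

step-∔ : ∀ m f g → step (suc m) (f ∔ g) ≐ step (suc m) f ∔ step (suc m) g
step-∔ m f g n = sym (step-unique m {f ∔ g} {step s f ∔ step s g} (λ n → begin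
  step s f n + step s g n
    ≡⟨ cong₂ _+_ (step-eq m f n) (step-eq m g n) ⟩
  f n + sh s f n + sh s (step s f) n + (g n + sh s g n + sh s (step s g) n)
    ≡⟨ lemma (f n) (sh s f n) _ (g n) (sh s g n) _ ⟩
  f n + g n + (sh s f n + sh s g n) + (sh s (step s f) n + sh s (step s g) n)
    ≡⟨ sym (cong₂ (λ x y → f n + g n + x + y) (sh-∔ s f g n) (sh-∔ s (step s f) (step s g) n)) ⟩
  f n + g n + sh s (f ∔ g) n + sh s (step s f ∔ step s g) n ∎) n)
  where
  open ≡-Reasoning
  s = suc m
  lemma : ∀ a b c d e f → a + b + c + (d + e + f) ≡ a + d + (b + e) + (c + f)
  lemma = solve-∀

step-sh : ∀ m k f → step (suc m) (sh k f) ≐ sh k (step (suc m) f)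
step-sh m k f n = sym (step-unique m {sh k f} {sh k (step s f)} (λ n → begin
  sh k (step s f) n                               ≡⟨ shift-cong 0 k (step-eq m f) n ⟩
  sh k (f ∔ sh s f ∔ sh s (step s f)) n           ≡⟨ trans (sh-∔ k _ _ n) (cong (_+ sh k (sh s (step s f)) n) (sh-∔ k _ _ n)) ⟩
  sh k f n + sh k (sh s f) n + sh k (sh s (step s f)) n
    ≡⟨ cong₂ (λ x y → sh k f n + x + y) (shift-comm 0 k s f n) (shift-comm 0 k s (step s f) n) ⟩
  sh k f n + sh s (sh k f) n + sh s (sh k (step s f)) n ∎) n)
  where
  open ≡-Reasoning
  s = suc m

Monotone : (ℕ → ℕ) → Set
Monotone f = ∀ n → f n ≤ f (suc n)

sh-monotone : ∀ m f n → (∀ k → k < n → f k ≤ f (suc k)) → sh (suc m) f n ≤ sh (suc m) f (suc n)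
sh-monotone m f n h = go m f n h
  where
  go : ∀ m f n → (∀ k → k < n → f k ≤ f (suc k)) → sh (suc m) f n ≤ sh m f n
  go m f zero h = z≤n
  go zero f (suc n) h = h n ≤-refl
  go (suc m) f (suc n) h = go m f n (λ k k<n → h k (m<n⇒m<1+n k<n))

step-monotone : ∀ m f → Monotone f → Monotone (step (suc m) f)
step-monotone m f mono = <-rec _ λ n rec → subst₂ _≤_ (sym (step-eq m f n)) (sym (step-eq m f (suc n)))
  (+-mono-≤ (+-mono-≤ (mono n) (sh-monotone m f n (λ k _ → mono k)))
            (sh-monotone m (step (suc m) f) n (λ k → rec {k})))

f≤step : ∀ m f n → f n ≤ step (suc m) f n
f≤step m f n = subst (f n ≤_) (sym (step-eq m f n)) (≤-trans (m≤m+n (f n) _) (m≤m+n _ _))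

step-< : ∀ m f n → n < suc m → step (suc m) f n ≡ f n
step-< m f n p = trans (step-eq m f n) (trans (cong₂ (λ x y → f n + x + y) (shift-< 0 f p) (shift-< 0 (step (suc m) f) p))
  (trans (+-identityʳ _) (+-identityʳ _)))

-- over m n counts overpartitions of n with all parts ≤ m.
over : ℕ → ℕ → ℕ
over zero zero = 1
over zero (suc n) = 0
over (suc m) = step (suc m) (over m)

p̄ : ℕ → ℕ
p̄ n = over n n

over-stable : ∀ m n → n ≤ m → over m n ≡ p̄ n
over-stable m n n≤m with m≤n⇒m<n∨m≡n n≤m
... | inj₂ refl = refl

over-stable (suc m) n _ | inj₁ n<m = trans (step-< m (over m) n n<m) (over-stable m n (s≤s⁻¹ n<m))

-- Convolution and the logarithmic derivative of the generating function

conv : (ℕ → ℕ) → (ℕ → ℕ) → ℕ → ℕ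
conv w f zero = w 0 * f 0
conv w f (suc n) = w 0 * f (suc n) + conv (w ∘ suc) f n

conv-congˡ : ∀ {w v} f n → (∀ k → k ≤ n → w k ≡ v k) → conv w f n ≡ conv v f n
conv-congˡ f zero e = cong (_* f 0) (e 0 z≤n)
conv-congˡ f (suc n) e = cong₂ (λ x y → x * f (suc n) + y) (e 0 z≤n) (conv-congˡ f n (λ k k≤n → e (suc k) (s≤s k≤n)))

conv-congʳ : ∀ w {f g} n → (∀ k → k ≤ n → f k ≡ g k) → conv w f n ≡ conv w g n
conv-congʳ w zero e = cong (w 0 *_) (e 0 z≤n)
conv-congʳ w (suc n) e = cong₂ (λ x y → w 0 * x + y) (e (suc n) ≤-refl) (conv-congʳ (w ∘ suc) n (λ k k≤n → e k (m≤n⇒m≤1+n k≤n)))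

conv-zeroˡ : ∀ f n → conv (λ _ → 0) f n ≡ 0
conv-zeroˡ f zero = refl
conv-zeroˡ f (suc n) = conv-zeroˡ f n

conv-∔ˡ : ∀ w v f → conv (w ∔ v) f ≐ conv w f ∔ conv v f
conv-∔ˡ w v f zero = *-distribʳ-+ (f 0) (w 0) (v 0)
conv-∔ˡ w v f (suc n) = trans (cong ((w 0 + v 0) * f (suc n) +_) (conv-∔ˡ (w ∘ suc) (v ∘ suc) f n))
  (lemma (w 0) (v 0) (f (suc n)) (conv (w ∘ suc) f n) (conv (v ∘ suc) f n))
  where
  lemma : ∀ a b x c d → (a + b) * x + (c + d) ≡ a * x + c + (b * x + d)
  lemma = solve-∀

conv-∔ʳ : ∀ w f g → conv w (f ∔ g) ≐ conv w f ∔ conv w g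
conv-∔ʳ w f g zero = *-distribˡ-+ (w 0) (f 0) (g 0)
conv-∔ʳ w f g (suc n) = trans (cong (w 0 * (f (suc n) + g (suc n)) +_) (conv-∔ʳ (w ∘ suc) f g n))
  (lemma (w 0) (f (suc n)) (g (suc n)) (conv (w ∘ suc) f n) (conv (w ∘ suc) g n))
  where
  lemma : ∀ a x y c d → a * (x + y) + (c + d) ≡ a * x + c + (a * y + d)
  lemma = solve-∀

conv-*ʳ : ∀ w c f n → conv w (λ k → c * f k) n ≡ c * conv w f n
conv-*ʳ w c f zero = lemma (w 0) c (f 0)
  where
  lemma : ∀ a c x → a * (c * x) ≡ c * (a * x)
  lemma = solve-∀
conv-*ʳ w c f (suc n) = trans (cong (w 0 * (c * f (suc n)) +_) (conv-*ʳ (w ∘ suc) c f n))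
  (lemma (w 0) c (f (suc n)) (conv (w ∘ suc) f n))
  where
  lemma : ∀ a c x y → a * (c * x) + c * y ≡ c * (a * x + y)
  lemma = solve-∀

conv-*ˡ : ∀ c w f n → conv (λ k → c * w k) f n ≡ c * conv w f n
conv-*ˡ c w f zero = *-assoc c (w 0) (f 0)
conv-*ˡ c w f (suc n) = trans (cong₂ _+_ (*-assoc c (w 0) (f (suc n))) (conv-*ˡ c (w ∘ suc) f n)) (sym (*-distribˡ-+ c _ _))

conv-shˡ : ∀ m w f → conv (sh m w) f ≐ sh m (conv w f)
conv-shˡ zero w f n = refl
conv-shˡ (suc m) w f zero = refl
conv-shˡ (suc m) w f (suc n) = conv-shˡ m w f n

conv-sh1ʳ : ∀ w f → conv w (sh 1 f) ≐ sh 1 (conv w f)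
conv-sh1ʳ w f zero = *-zeroʳ (w 0)
conv-sh1ʳ w f (suc zero) = trans (cong (w 0 * f 0 +_) (*-zeroʳ (w 1))) (+-identityʳ _)
conv-sh1ʳ w f (suc (suc n)) = cong (w 0 * f (suc n) +_) (conv-sh1ʳ (w ∘ suc) f (suc n))

conv-shʳ : ∀ m w f → conv w (sh m f) ≐ sh m (conv w f)
conv-shʳ zero w f n = refl
conv-shʳ (suc m) w f n = begin
  conv w (sh (suc m) f) n    ≡⟨ conv-congʳ w n (λ k _ → sym (shift-+ 0 1 m f k)) ⟩
  conv w (sh 1 (sh m f)) n   ≡⟨ conv-sh1ʳ w (sh m f) n ⟩
  sh 1 (conv w (sh m f)) n   ≡⟨ shift-cong 0 1 (conv-shʳ m w f) n ⟩
  sh 1 (sh m (conv w f)) n   ≡⟨ shift-+ 0 1 m (conv w f) n ⟩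
  sh (suc m) (conv w f) n    ∎
  where open ≡-Reasoning

conv-mono-≤ˡ : ∀ {w v} f n → (∀ k → w k ≤ v k) → conv w f n ≤ conv v f n
conv-mono-≤ˡ f zero h = *-monoˡ-≤ (f 0) (h 0)
conv-mono-≤ˡ f (suc n) h = +-mono-≤ (*-monoˡ-≤ (f (suc n)) (h 0)) (conv-mono-≤ˡ f n (h ∘ suc))

conv-mono-≤ʳ : ∀ w {f g} n → (∀ k → k ≤ n → f k ≤ g k) → conv w f n ≤ conv w g n
conv-mono-≤ʳ w zero h = *-monoʳ-≤ (w 0) (h 0 z≤n)
conv-mono-≤ʳ w (suc n) h = +-mono-≤ (*-monoʳ-≤ (w 0) (h (suc n) ≤-refl)) (conv-mono-≤ʳ (w ∘ suc) n (λ k k≤n → h k (m≤n⇒m≤1+n k≤n)))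

partialSum : (ℕ → ℕ) → ℕ → ℕ
partialSum f zero = f 0
partialSum f (suc n) = f (suc n) + partialSum f n

conv-≤-partialSum : ∀ {b} w f n → (∀ k → k ≤ n → w k ≤ b) → conv w f n ≤ b * partialSum f n
conv-≤-partialSum w f zero h = *-monoˡ-≤ (f 0) (h 0 z≤n)
conv-≤-partialSum {b} w f (suc n) h = ≤-trans
  (+-mono-≤ (*-monoˡ-≤ (f (suc n)) (h 0 z≤n)) (conv-≤-partialSum (w ∘ suc) f n (λ k k≤n → h (suc k) (s≤s k≤n))))
  (≤-reflexive (sym (*-distribˡ-+ b (f (suc n)) _)))

const₀ : ℕ → ℕ → ℕ
const₀ c zero = c
const₀ c (suc n) = 0

conv-const₀ : ∀ c f n → conv (const₀ c) f n ≡ c * f n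
conv-const₀ c f zero = refl
conv-const₀ c f (suc n) = trans (cong (c * f (suc n) +_) (conv-zeroˡ f n)) (+-identityʳ _)

-- q d/dq of log ((1 + q^i) / (1 - q^i)) is 2i q^i / (1 - q^2i), the sum of 2i q^k over the odd multiples k of i.
oddMultiples : ℕ → ℕ → ℕ
oddMultiples i = geo (i + i) (sh i (const₀ (2 * i)))

oddMultiples-eq : ∀ i → oddMultiples (suc i) ≐ sh (suc i) (const₀ (2 * suc i) ∔ sh (suc i) (oddMultiples (suc i)))
oddMultiples-eq i n = begin
  oddMultiples s n                                           ≡⟨ geo-eq (i + s) (sh s c) n ⟩
  sh s c n + sh (s + s) (oddMultiples s) n                   ≡⟨ cong (sh s c n +_) (sym (shift-+ 0 s s (oddMultiples s) n)) ⟩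
  sh s c n + sh s (sh s (oddMultiples s)) n                  ≡⟨ sym (sh-∔ s c _ n) ⟩
  sh s (c ∔ sh s (oddMultiples s)) n                         ∎
  where
  open ≡-Reasoning
  s = suc i
  c = const₀ (2 * s)

oddMultiples-< : ∀ i n → n < suc i → oddMultiples (suc i) n ≡ 0
oddMultiples-< i n p = trans (oddMultiples-eq i n) (shift-< 0 _ p)

oddMultiples-self : ∀ i → oddMultiples (suc i) (suc i) ≡ 2 * suc i
oddMultiples-self i = trans (oddMultiples-eq i (suc i))
  (trans (cong (sh i (const₀ (2 * suc i) ∔ sh (suc i) (oddMultiples (suc i)))) (sym (+-identityʳ i)))
  (trans (shift-≥ 0 i 0 _) (+-identityʳ _)))

oddMultiples-≤ : ∀ i n → oddMultiples (suc i) n ≤ 2 * suc i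
oddMultiples-≤ i = <-rec _ λ n rec → ≤-trans (≤-reflexive (oddMultiples-eq i n))
  -- At index i itself `const₀` contributes 2i and the shifted rest 0; further on only the rest
  -- contributes, so the two never add up.
  (shift-rel {A = ℕ} {B = ℕ} (λ x _ → x ≤ 2 * suc i) {0} {0} z≤n i {g = id} n (λ { zero _ → ≤-reflexive (+-identityʳ _)
    ; (suc k) k<n → shift-rel {B = ℕ} (λ x _ → x ≤ 2 * suc i) {y = 0} z≤n i {g = id} (suc k)
      (λ j j<k → rec (<-trans j<k k<n)) }))

logDeriv : ℕ → ℕ → ℕ
logDeriv zero k = 0
logDeriv (suc m) k = logDeriv m k + oddMultiples (suc m) k

-- With P = f (1 + q^s) / (1 - q^s) one has f + P = 2f / (1 - q^s), so both sides are 2s q^s f / (1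
-- - q^s)^2. In the proof X and the solution Y of the claimed equation are both shown to solve Z =
-- 2s q^s P + q^(2s) Z.
step-conv-oddMultiples : ∀ m f → let s = suc m; P = step s f; X = conv (oddMultiples s) P in
  X ≐ (λ n → s * (sh s f n + sh s P n)) ∔ sh s X
step-conv-oddMultiples m f n = trans (sh-unique (m + s) X-eq Y-eq n)
  (trans (geo-eq m _ n) (cong (u n +_) (shift-cong 0 s (λ k → sym (sh-unique (m + s) X-eq Y-eq k)) n)))
  where
  open ≡-Reasoning
  s = suc m
  P = step s f
  w = oddMultiples s
  X = conv w P
  u : ℕ → ℕ
  u n = s * (sh s f n + sh s P n)
  Y = geo s u
  X-eq : X ≐ (λ k → 2 * s * sh s P k) ∔ sh (s + s) X
  X-eq k = begin
    conv w P k
      ≡⟨ conv-congˡ P k (λ j _ → geo-eq (m + s) _ j) ⟩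
    conv (sh s (const₀ (2 * s)) ∔ sh (s + s) w) P k
      ≡⟨ conv-∔ˡ (sh s (const₀ (2 * s))) (sh (s + s) w) P k ⟩
    conv (sh s (const₀ (2 * s))) P k + conv (sh (s + s) w) P k
      ≡⟨ cong₂ _+_ (conv-shˡ s _ P k) (conv-shˡ (s + s) w P k) ⟩
    sh s (conv (const₀ (2 * s)) P) k + sh (s + s) X k
      ≡⟨ cong (_+ sh (s + s) X k) (trans (shift-cong 0 s (conv-const₀ (2 * s) P) k) (sh-* s (2 * s) P k)) ⟩
    2 * s * sh s P k + sh (s + s) X k ∎
  sh-u : ∀ k → sh s u k ≡ s * (sh s (sh s f) k + sh s (sh s P) k)
  sh-u k = trans (sh-* s s _ k) (cong (s *_) (sh-∔ s (sh s f) (sh s P) k))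
  sh-P : ∀ k → sh s P k ≡ sh s f k + sh s (sh s f) k + sh s (sh s P) k
  sh-P k = trans (shift-cong 0 s (step-eq m f) k)
    (trans (sh-∔ s _ _ k) (cong (_+ sh s (sh s P) k) (sh-∔ s f _ k)))
  lemma : ∀ s a b c d y → s * (a + d) + (s * (b + c) + y) ≡ s * (a + b + c) + s * d + y
  lemma = solve-∀
  lemma′ : ∀ s d y → s * d + s * d + y ≡ 2 * s * d + y
  lemma′ = solve-∀
  Y-eq : Y ≐ (λ k → 2 * s * sh s P k) ∔ sh (s + s) Y
  Y-eq k = begin
    Y k                                        ≡⟨ geo-eq m u k ⟩
    u k + sh s Y k                             ≡⟨ cong (u k +_) (trans (shift-cong 0 s (geo-eq m u) k) (sh-∔ s u (sh s Y) k)) ⟩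
    u k + (sh s u k + sh s (sh s Y) k)         ≡⟨ cong₂ (λ x y → u k + (x + y)) (sh-u k) (shift-+ 0 s s Y k) ⟩
    s * (sh s f k + sh s P k) + (s * (sh s (sh s f) k + sh s (sh s P) k) + sh (s + s) Y k)
      ≡⟨ lemma s (sh s f k) (sh s (sh s f) k) (sh s (sh s P) k) (sh s P k) (sh (s + s) Y k) ⟩
    s * (sh s f k + sh s (sh s f) k + sh s (sh s P) k) + s * sh s P k + sh (s + s) Y k
      ≡⟨ cong (λ x → s * x + s * sh s P k + sh (s + s) Y k) (sym (sh-P k)) ⟩
    s * sh s P k + s * sh s P k + sh (s + s) Y k ≡⟨ lemma′ s (sh s P k) _ ⟩
    2 * s * sh s P k + sh (s + s) Y k ∎

-- The product rule for q d/dq applied to q^m f.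
n*sh : ∀ m f n → n * sh m f n ≡ m * sh m f n + sh m (λ k → k * f k) n
n*sh zero f n = refl
n*sh (suc m) f zero = sym (trans (+-identityʳ _) (*-zeroʳ m))
n*sh (suc m) f (suc n) = trans (cong (sh m f n +_) (n*sh m f n)) (sym (+-assoc (sh m f n) _ _))

-- Differentiating the equation of `step` and convolving that equation with `logDeriv` give the same
-- equation with inhomogeneous term `v`; the induction hypothesis matches the terms in f, and
-- `step-conv-oddMultiples` those from the new factor.
over-logDeriv : ∀ m n → n * over m n ≡ conv (logDeriv m) (over m) n
over-logDeriv zero zero = refl
over-logDeriv zero (suc n) = trans (*-zeroʳ n) (sym (conv-zeroˡ (over 0) n))
over-logDeriv (suc m) = sh-unique m {v} D-eq C-eq
  where
  open ≡-Reasoning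
  s = suc m
  f = over m
  P = step s f
  W = logDeriv m
  w = oddMultiples s
  D : (ℕ → ℕ) → ℕ → ℕ
  D g k = k * g k
  v : ℕ → ℕ
  v k = conv W f k + sh s (conv W f) k + s * (sh s f k + sh s P k)
  lemma : ∀ n a b c → n * (a + b + c) ≡ n * a + n * b + n * c
  lemma = solve-∀
  lemma′ : ∀ x y z a b s → x + (s * a + y) + (s * b + z) ≡ x + y + s * (a + b) + z
  lemma′ = solve-∀
  D-eq : D P ≐ v ∔ sh s (D P)
  D-eq k = begin
    k * P k                                        ≡⟨ cong (k *_) (step-eq m f k) ⟩
    k * (f k + sh s f k + sh s P k)                ≡⟨ lemma k (f k) (sh s f k) (sh s P k) ⟩
    k * f k + k * sh s f k + k * sh s P k          ≡⟨ cong₂ (λ x y → k * f k + x + y) (n*sh s f k) (n*sh s P k) ⟩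
    k * f k + (s * sh s f k + sh s (D f) k) + (s * sh s P k + sh s (D P) k)
      ≡⟨ lemma′ (k * f k) (sh s (D f) k) _ (sh s f k) (sh s P k) s ⟩
    k * f k + sh s (D f) k + s * (sh s f k + sh s P k) + sh s (D P) k
      ≡⟨ cong₂ (λ x y → x + y + s * (sh s f k + sh s P k) + sh s (D P) k) (over-logDeriv m k) (shift-cong 0 s (over-logDeriv m) k) ⟩
    v k + sh s (D P) k ∎
  lemma″ : ∀ a b c d e → a + b + c + (d + e) ≡ a + b + d + (c + e)
  lemma″ = solve-∀
  C-eq : conv (logDeriv s) P ≐ v ∔ sh s (conv (logDeriv s) P)
  C-eq k = begin
    conv (W ∔ w) P k                              ≡⟨ conv-∔ˡ W w P k ⟩
    conv W P k + conv w P k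
      ≡⟨ cong₂ _+_ (trans (conv-congʳ W k (λ j _ → step-eq m f j)) (conv-∔ʳ W (f ∔ sh s f) (sh s P) k)) (step-conv-oddMultiples m f k) ⟩
    conv W (f ∔ sh s f) k + conv W (sh s P) k + (s * (sh s f k + sh s P k) + sh s (conv w P) k)
      ≡⟨ cong₂ (λ x y → x + y + (s * (sh s f k + sh s P k) + sh s (conv w P) k))
           (trans (conv-∔ʳ W f (sh s f) k) (cong (conv W f k +_) (conv-shʳ s W f k))) (conv-shʳ s W P k) ⟩
    conv W f k + sh s (conv W f) k + sh s (conv W P) k + (s * (sh s f k + sh s P k) + sh s (conv w P) k)
      ≡⟨ lemma″ (conv W f k) (sh s (conv W f) k) (sh s (conv W P) k) _ _ ⟩
    v k + (sh s (conv W P) k + sh s (conv w P) k)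
      ≡⟨ cong (v k +_) (trans (sym (sh-∔ s (conv W P) (conv w P) k)) (shift-cong 0 s (λ j → sym (conv-∔ˡ W w P j)) k)) ⟩
    v k + sh s (conv (W ∔ w) P) k ∎

logDeriv-stable : ∀ m k → k ≤ m → logDeriv m k ≡ logDeriv k k
logDeriv-stable m k k≤m with m≤n⇒m<n∨m≡n k≤m
... | inj₂ refl = refl
logDeriv-stable (suc m) k _ | inj₁ k<m = trans (cong₂ _+_ (logDeriv-stable m k (s≤s⁻¹ k<m)) (oddMultiples-< m k k<m)) (+-identityʳ _)

-- The sum of 2i over the divisors i of k with k / i odd.
σ : ℕ → ℕ
σ k = logDeriv k k

p̄-logDeriv : ∀ n → n * p̄ n ≡ conv σ p̄ n
p̄-logDeriv n = trans (over-logDeriv n n)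
  (trans (conv-congˡ (over n) n (logDeriv-stable n)) (conv-congʳ σ n (over-stable n)))

-- The divisor i = k alone contributes 2k.
σ-≥ : ∀ k → 2 * k ≤ σ k
σ-≥ zero = z≤n
σ-≥ (suc k) = ≤-trans (≤-reflexive (sym (oddMultiples-self k))) (m≤n+m _ (logDeriv k (suc k)))

-- Every i ≤ k contributes at most 2i.
σ-≤ : ∀ k → σ k ≤ k * suc k
σ-≤ k = go k k
  where
  lemma : ∀ m → m * suc m + 2 * suc m ≡ suc m * suc (suc m)
  lemma = solve-∀
  go : ∀ m k → logDeriv m k ≤ m * suc m
  go zero k = z≤n
  go (suc m) k = ≤-trans (+-mono-≤ (go m k) (oddMultiples-≤ m k)) (≤-reflexive (lemma m))

-- Propagating slow growth from a computed range

-- A closed form made for evaluation: k is an odd multiple of s exactly if it leaves remainder s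
-- modulo 2s.
oddMultiplesMod : ℕ → ℕ → ℕ
oddMultiplesMod i k = if k % (suc i + suc i) ≡ᵇ suc i then 2 * suc i else 0

const₀-≡ᵇ : ∀ c m n → sh m (const₀ c) n ≡ (if n ≡ᵇ m then c else 0)
const₀-≡ᵇ c zero zero = refl
const₀-≡ᵇ c zero (suc n) = refl
const₀-≡ᵇ c (suc m) zero = refl
const₀-≡ᵇ c (suc m) (suc n) = const₀-≡ᵇ c m n

oddMultiples-mod : ∀ i → oddMultiples (suc i) ≐ oddMultiplesMod i
oddMultiples-mod i n = sym (sh-unique (i + s) mod-eq (geo-eq (i + s) (sh s c)) n)
  where
  s = suc i
  c = const₀ (2 * s)
  h = oddMultiplesMod i
  mod-eq : h ≐ sh s c ∔ sh (s + s) h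
  mod-eq n with n <? s + s
  ... | yes n<2s rewrite m<n⇒m%n≡m n<2s | shift-< 0 h n<2s = trans (sym (const₀-≡ᵇ (2 * s) s n)) (sym (+-identityʳ _))
  ... | no n≮2s with m≤n⇒∃[o]m+o≡n (≮⇒≥ n≮2s)
  ... | j , refl = begin
    h (s + s + j)                              ≡⟨ cong (λ x → if x ≡ᵇ s then 2 * s else 0) (trans (cong (_% (s + s)) (+-comm (s + s) j)) ([m+n]%n≡m%n j (s + s))) ⟩
    h j                                        ≡⟨ sym (cong₂ _+_ (trans (cong (sh s c) (+-assoc s s j)) (shift-≥ 0 s (s + j) c)) (shift-≥ 0 (s + s) j h)) ⟩
    sh s c (s + s + j) + sh (s + s) h (s + s + j) ∎
    where open ≡-Reasoning

logDerivMod : ℕ → ℕ → ℕ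
logDerivMod zero k = 0
logDerivMod (suc i) k = logDerivMod i k + oddMultiplesMod i k

logDeriv-mod : ∀ m → logDeriv m ≐ logDerivMod m
logDeriv-mod zero k = refl
logDeriv-mod (suc m) k = cong₂ _+_ (logDeriv-mod m k) (oddMultiples-mod m k)

dot : List ℕ → List ℕ → ℕ
dot _ [] = 0
dot [] (_ ∷ _) = 0
dot (x ∷ xs) (y ∷ ys) = x * y + dot xs ys

-- Values for n, ..., 0, latest first, so that the recurrence for the next value is a dot product
-- with the list already present.
table : List ℕ → ℕ → List ℕ
table ws zero = 1 ∷ []
table ws (suc n) = extend (table ws n)
  where
  extend : List ℕ → List ℕ
  extend t = dot ws t / suc n ∷ t

σ-table : ℕ → List ℕ
σ-table = applyUpTo (λ k → logDerivMod (suc k) (suc k))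

dot-conv : ∀ {w v} f N n → v ≐ w → n < N → dot (applyUpTo v N) (applyDownFrom f (suc n)) ≡ conv w f n
dot-conv f (suc N) zero e p = trans (+-identityʳ _) (cong (_* f 0) (e 0))
dot-conv f (suc N) (suc n) e (s≤s p) = cong₂ (λ x y → x * f (suc n) + y) (e 0) (dot-conv f N n (e ∘ suc) p)

-- The numerical part is carried out for a variable f with this property and f 0 = 1. Evaluation
-- then takes place in `table` only and can never unfold `p̄`.
LogDerivσ : (ℕ → ℕ) → Set
LogDerivσ f = ∀ n → n * f n ≡ conv σ f n

table-correct : ∀ f → LogDerivσ f → f 0 ≡ 1 → ∀ N n → n ≤ N → table (σ-table N) n ≡ applyDownFrom f (suc n)
table-correct f L f0 N zero p = cong (_∷ []) (sym f0)
table-correct f L f0 N (suc n) p rewrite table-correct f L f0 N n (<⇒≤ p) = cong (_∷ applyDownFrom f (suc n)) (begin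
  dot (σ-table N) (applyDownFrom f (suc n)) / suc n
    -- Since `σ 0` is 0, the summand containing `f (suc n)` disappears by computation and the
    -- weights start at `σ 1`.
    ≡⟨ cong (_/ suc n) (dot-conv f N n (λ k → sym (logDeriv-mod (suc k) (suc k))) p) ⟩
  conv σ f (suc n) / suc n                          ≡⟨ cong (_/ suc n) (sym (L (suc n))) ⟩
  suc n * f (suc n) / suc n                         ≡⟨ cong (_/ suc n) (*-comm (suc n) (f (suc n))) ⟩
  f (suc n) * suc n / suc n                         ≡⟨ m*n/n≡m (f (suc n)) (suc n) ⟩
  f (suc n)                                         ∎)
  where open ≡-Reasoning

-- For c ≤ 5 it suffices that p̄(n) − p̄(n−2) ≤ 0.236 p̄(n).
Slow : (ℕ → ℕ) → ℕ → Set
Slow f n = f (2 + n) * 764 ≤ f n * 1000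

slow? : ℕ → List ℕ → Bool
slow? (suc c) (x ∷ t@(_ ∷ y ∷ _)) = (x * 764 ≤ᵇ y * 1000) ∧ slow? c t
slow? (suc c) _ = false
slow? zero _ = true

slow?-sound : ∀ f c N → T (slow? c (applyDownFrom f (3 + N))) → ∀ n → n ≤ N → N < n + c → Slow f n
slow?-sound f zero N h n n≤N N<n+c with <⇒≱ N<n+c (subst (_≤ N) (sym (+-identityʳ n)) n≤N)
... | ()
slow?-sound f (suc c) N h n n≤N N<n+c with Equivalence.to (T-∧ {f (2 + N) * 764 ≤ᵇ f N * 1000}) h | m≤n⇒m<n∨m≡n n≤N
... | h₁ , h₂ | inj₂ refl = ≤ᵇ⇒≤ _ _ h₁
slow?-sound f (suc c) (suc N) h n _ N<n+c | h₁ , h₂ | inj₁ n<N =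
  slow?-sound f c N h₂ n (s≤s⁻¹ n<N) (s≤s⁻¹ (subst (suc N <_) (+-suc n c) N<n+c))

sum-table : ∀ f d n → foldr _+_ 0 (drop d (applyDownFrom f (d + suc n))) ≡ partialSum f n
sum-table f zero zero = +-identityʳ _
sum-table f zero (suc n) = cong (f (suc n) +_) (sum-table f zero n)
sum-table f (suc d) n = sum-table f d n

-- The growth that makes the recurrence for n * f n propagate Slow: S bounds the sum of the initial values, where Slow fails.
Growth : ℕ → (ℕ → ℕ) → ℕ → Set
Growth S f n = S * 764 * ((2 + n) * (3 + n)) ≤ f n * 2000

check : List ℕ → Bool
-- For a list of the values at 271, ..., 0: the 149 comparisons have their larger index running from
-- 271 down to 123, what remains after `drop 149` are the values at 122, ..., 0, and x is the value
-- at 270.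
check t@(_ ∷ x ∷ _) = slow? 149 t ∧ (foldr _+_ 0 (drop 149 t) * 764 * (272 * 273) ≤ᵇ x * 2000)
check _ = false

initial-range : ∀ f → LogDerivσ f → f 0 ≡ 1 → (∀ n → n ≤ 269 → 269 < n + 149 → Slow f n) × Growth (partialSum f 122) f 270
initial-range f L f0 = slow?-sound f 149 269 (proj₁ both) ,
  subst (λ S → Growth S f 270) (sum-table f 149 122) (≤ᵇ⇒≤ _ _ (proj₂ both))
  where
  both = Equivalence.to (T-∧ {slow? 149 (applyDownFrom f 272)})
    -- Accepting `tt` means evaluating the check on the table up to 271.
    (subst (T ∘ check) (table-correct f L f0 271 271 ≤-refl) tt)

-- The correction that makes the two-step inequality hold at every index: up to M, where it may
-- fail, the whole value is put into the correction.
truncate : ℕ → (ℕ → ℕ) → ℕ → ℕ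
truncate M f n with n ≤? M
... | yes _ = f n
... | no _ = 0

truncate-≤ : ∀ M f n → truncate M f n ≤ f n
truncate-≤ M f n with n ≤? M
... | yes _ = ≤-refl
... | no _ = z≤n

partialSum-mono-≤ : ∀ {f g} n → (∀ k → f k ≤ g k) → partialSum f n ≤ partialSum g n
partialSum-mono-≤ zero h = h 0
partialSum-mono-≤ (suc n) h = +-mono-≤ (h (suc n)) (partialSum-mono-≤ n h)

partialSum-monotone : ∀ f {m n} → m ≤′ n → partialSum f m ≤ partialSum f n
partialSum-monotone f ≤′-refl = ≤-refl
partialSum-monotone f (≤′-step p) = ≤-trans (partialSum-monotone f p) (m≤n+m _ _)

partialSum-truncate : ∀ M f n → partialSum (truncate M f) n ≤ partialSum f M
partialSum-truncate M f zero = ≤-trans (truncate-≤ M f 0) (partialSum-monotone f {0} {M} (≤⇒≤′ z≤n))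
partialSum-truncate M f (suc n) with suc n ≤? M
... | yes p = ≤-trans (+-monoʳ-≤ (f (suc n)) (partialSum-mono-≤ n (truncate-≤ M f))) (partialSum-monotone f (≤⇒≤′ p))
... | no p = partialSum-truncate M f n

slow-step : ∀ f a b M n → 1 ≤ M → LogDerivσ f →
  (∀ k → M < 2 + k → k < n → f (2 + k) * a ≤ f k * b) →
  partialSum f M * a * ((2 + n) * (3 + n)) ≤ f n * (2 * b) → f (2 + n) * a ≤ f n * b
slow-step f a b M n 1≤M L slow growth = *-cancelˡ-≤ (2 + n) (begin
  N * (f N * a)                                    ≡⟨ lemma₁ N (f N) a ⟩
  a * (N * f N)                                    ≡⟨ cong (a *_) (L N) ⟩
  -- As `σ 0` is 0, index N, which is the inequality being proved, does not occur, and `termwise`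
  -- may rely on smaller indices alone.
  a * conv σ f N                                   ≡⟨ sym (conv-*ʳ σ a f N) ⟩
  conv σ (λ k → a * f k) N                         ≤⟨ conv-mono-≤ʳ (σ ∘ suc) (suc n) termwise ⟩
  conv σ (sh 2 (λ k → b * f k) ∔ (λ k → a * e k)) N ≡⟨ conv-∔ʳ σ (sh 2 (λ k → b * f k)) (λ k → a * e k) N ⟩
  conv σ (sh 2 (λ k → b * f k)) N + conv σ (λ k → a * e k) N
    ≡⟨ cong₂ _+_ (trans (conv-shʳ 2 σ (λ k → b * f k) N) (conv-*ʳ σ b f n)) (conv-*ʳ σ a e N) ⟩
  b * conv σ f n + a * conv σ e N                  ≡⟨ cong (λ x → b * x + a * conv σ e N) (sym (L n)) ⟩
  b * (n * f n) + a * conv σ e N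
    ≤⟨ +-monoʳ-≤ _ (*-monoʳ-≤ a (≤-trans (conv-≤-partialSum σ e N (λ k k≤N → ≤-trans (σ-≤ k) (*-mono-≤ k≤N (s≤s k≤N))))
        (*-monoʳ-≤ (N * suc N) (partialSum-truncate M f N)))) ⟩
  b * (n * f n) + a * (N * suc N * S)              ≡⟨ cong (b * (n * f n) +_) (lemma₂ a (N * suc N) S) ⟩
  b * (n * f n) + S * a * (N * suc N)              ≤⟨ +-monoʳ-≤ _ growth ⟩
  b * (n * f n) + f n * (2 * b)                    ≡⟨ lemma₃ b n (f n) ⟩
  N * (f n * b)                                    ∎)
  where
  open ≤-Reasoning
  N = 2 + n
  S = partialSum f M
  e = truncate M f
  lemma₁ : ∀ N x a → N * (x * a) ≡ a * (N * x)
  lemma₁ = solve-∀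
  lemma₂ : ∀ a t S → a * (t * S) ≡ S * a * t
  lemma₂ = solve-∀
  lemma₃ : ∀ b n x → b * (n * x) + x * (2 * b) ≡ (2 + n) * (x * b)
  lemma₃ = solve-∀
  termwise : ∀ k → k ≤ suc n → a * f k ≤ sh 2 (λ j → b * f j) k + a * e k
  termwise k k≤n with k ≤? M
  ... | yes _ = m≤n+m _ _
  termwise 0 _ | no k≰M with k≰M z≤n
  ... | ()
  termwise 1 _ | no k≰M with k≰M 1≤M
  ... | ()
  termwise (suc (suc k)) (s≤s k<n) | no k≰M = ≤-trans (subst₂ _≤_ (*-comm _ a) (*-comm _ b) (slow k (≰⇒> k≰M) k<n)) (m≤m+n _ _)

-- Lower bounds on growth from the recurrence

differences : (ℕ → ℕ) → ℕ → ℕ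
differences f zero = f 0
differences f (suc n) = f (suc n) ∸ f n

conv-one-differences : ∀ f → Monotone f → conv (λ _ → 1) (differences f) ≐ f
conv-one-differences f mono = sh-unique 0 (λ n → trans (conv-congˡ d n (λ { zero _ → refl ; (suc k) _ → refl }))
    (trans (conv-∔ˡ (const₀ 1) (sh 1 (λ _ → 1)) d n)
      (cong₂ _+_ (trans (conv-const₀ 1 d n) (+-identityʳ _)) (conv-shˡ 1 (λ _ → 1) d n)))) f-eq
  where
  d = differences f
  f-eq : f ≐ d ∔ sh 1 f
  f-eq zero = sym (+-identityʳ _)
  f-eq (suc n) = sym (m∸n+n≡m (mono n))

-- Write f = d + q f with d the nonnegative differences. In the recurrence at n + 1 the part q f
-- yields n f(n). Replacing σ by the smaller weight `v` turns the part d into tail sums of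
-- differences, which telescope to values of f.
increment : ∀ f → Monotone f → LogDerivσ f → ∀ n →
  n * f n + 2 * (f n + sh 1 f n + sh 2 f n) ≤ suc n * f (suc n)
increment f mono L n = begin
  n * f n + 2 * (f n + sh 1 f n + sh 2 f n)     ≡⟨ +-comm (n * f n) _ ⟩
  2 * (f n + sh 1 f n + sh 2 f n) + n * f n     ≡⟨ cong₂ _+_ (sym conv-v) (L n) ⟩
  conv v d (suc n) + conv σ f n                 ≤⟨ +-monoˡ-≤ _ (conv-mono-≤ˡ d (suc n) (λ k → ≤-trans (v-≤ k) (σ-≥ k))) ⟩
  conv σ d (suc n) + conv σ f n                 ≡⟨ cong (conv σ d (suc n) +_) (sym (conv-shʳ 1 σ f (suc n))) ⟩
  conv σ d (suc n) + conv σ (sh 1 f) (suc n)    ≡⟨ sym (conv-∔ʳ σ d (sh 1 f) (suc n)) ⟩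
  conv σ (d ∔ sh 1 f) (suc n)                   ≡⟨ conv-congʳ σ (suc n) (λ { zero _ → +-identityʳ _ ; (suc k) _ → m∸n+n≡m (mono k) }) ⟩
  conv σ f (suc n)                              ≡⟨ sym (L (suc n)) ⟩
  suc n * f (suc n)                             ∎
  where
  open ≤-Reasoning
  d = differences f
  one v : ℕ → ℕ
  one _ = 1
  -- This is 2 min(k, 3), written as a sum of shifted constants.
  v k = 2 * (sh 1 one k + sh 2 one k + sh 3 one k)
  v-≤ : ∀ k → v k ≤ 2 * k
  v-≤ 0 = z≤n
  v-≤ 1 = ≤-refl
  v-≤ 2 = ≤-refl
  v-≤ (suc (suc (suc k))) = *-monoʳ-≤ 2 (s≤s (s≤s (s≤s z≤n)))
  conv-sh-one : ∀ m → conv (sh m one) d (suc n) ≡ sh m f (suc n)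
  conv-sh-one m = trans (conv-shˡ m one d (suc n)) (shift-cong 0 m (conv-one-differences f mono) (suc n))
  conv-v : conv v d (suc n) ≡ 2 * (f n + sh 1 f n + sh 2 f n)
  conv-v = trans (conv-*ˡ 2 (sh 1 one ∔ sh 2 one ∔ sh 3 one) d (suc n)) (cong (2 *_)
    (trans (conv-∔ˡ (sh 1 one ∔ sh 2 one) (sh 3 one) d (suc n)) (cong₂ _+_
      (trans (conv-∔ˡ (sh 1 one) (sh 2 one) d (suc n)) (cong₂ _+_ (conv-sh-one 1) (conv-sh-one 2)))
      (conv-sh-one 3))))

-- In `increment` at m = n + 2, the terms f(m-1) and f(m-2) are both at least f(m)/2, so the
-- increment is at least 4 f(m).
growth-ratio : ∀ f → Monotone f → LogDerivσ f → ∀ n → f (2 + n) ≤ 2 * f n → (6 + n) * f (2 + n) ≤ (3 + n) * f (3 + n)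
growth-ratio f mono L n h = begin
  (6 + n) * f (2 + n)                                   ≡⟨ lemma n (f (2 + n)) ⟩
  (2 + n) * f (2 + n) + 2 * (f (2 + n) + f (2 + n))     ≤⟨ +-monoʳ-≤ ((2 + n) * f (2 + n)) (*-monoʳ-≤ 2 (+-monoʳ-≤ (f (2 + n)) h)) ⟩
  (2 + n) * f (2 + n) + 2 * (f (2 + n) + 2 * f n)       ≤⟨ +-monoʳ-≤ ((2 + n) * f (2 + n)) (*-monoʳ-≤ 2 (≤-trans (≤-reflexive (lemma′ (f (2 + n)) (f n))) (+-monoˡ-≤ (f n) (+-monoʳ-≤ (f (2 + n)) (mono n))))) ⟩
  (2 + n) * f (2 + n) + 2 * (f (2 + n) + f (1 + n) + f n) ≤⟨ increment f mono L (2 + n) ⟩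
  (3 + n) * f (3 + n)                                   ∎
  where
  open ≤-Reasoning
  lemma : ∀ n x → (6 + n) * x ≡ (2 + n) * x + 2 * (x + x)
  lemma = solve-∀
  lemma′ : ∀ x y → x + 2 * y ≡ x + y + y
  lemma′ = solve-∀

-- The quadratic grows by the factor (n+4)/(n+2), while f grows at least by (n+4)/(n+1).
growth-step : ∀ f S n → (4 + n) * f n ≤ (1 + n) * f (1 + n) → Growth S f n → Growth S f (1 + n)
growth-step f S n ratio g = *-cancelˡ-≤ (2 + n) (begin
  (2 + n) * (S * 764 * ((3 + n) * (4 + n)))      ≡⟨ lemma (2 + n) (S * 764) (3 + n) (4 + n) ⟩
  S * 764 * ((2 + n) * (3 + n)) * (4 + n)        ≤⟨ *-monoˡ-≤ (4 + n) g ⟩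
  f n * 2000 * (4 + n)                           ≡⟨ lemma′ (f n) 2000 (4 + n) ⟩
  (4 + n) * f n * 2000                           ≤⟨ *-monoˡ-≤ 2000 (≤-trans ratio (*-monoˡ-≤ (f (1 + n)) (n≤1+n (1 + n)))) ⟩
  (2 + n) * f (1 + n) * 2000                     ≡⟨ *-assoc (2 + n) (f (1 + n)) 2000 ⟩
  (2 + n) * (f (1 + n) * 2000)                   ∎)
  where
  open ≤-Reasoning
  lemma : ∀ a s b c → a * (s * (b * c)) ≡ s * (a * b) * c
  lemma = solve-∀
  lemma′ : ∀ x y z → x * y * z ≡ z * x * y
  lemma′ = solve-∀

slow-doubling : ∀ f n → Slow f n → f (2 + n) ≤ 2 * f n
slow-doubling f n h = *-cancelʳ-≤ (f (2 + n)) (2 * f n) 764 (≤-trans h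
  (≤-trans (*-monoʳ-≤ (f n) {1000} {1528} (≤ᵇ⇒≤ _ _ _)) (≤-reflexive (trans (sym (*-assoc (f n) 2 764)) (cong (_* 764) (*-comm (f n) 2))))))

-- A joint induction: `Growth` at n gives `Slow` at n, and `Slow` at n - 2 gives the doubling bound
-- from which `Growth` at n + 1 follows.
eventually-slow : ∀ f → Monotone f → LogDerivσ f → f 0 ≡ 1 →
  ∀ d → (∀ k → 122 < 2 + k → k < d + 270 → Slow f k) × Growth (partialSum f 122) f (d + 270)
eventually-slow f mono L f0 zero = (λ k p q → proj₁ (initial-range f L f0) k (s≤s⁻¹ q)
  (+-monoˡ-≤ 149 (s≤s⁻¹ (s≤s⁻¹ p)))) , proj₂ (initial-range f L f0)
eventually-slow f mono L f0 (suc d) with eventually-slow f mono L f0 d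
... | slow , growth = slow′ , growth-step f (partialSum f 122) (d + 270)
  (subst (λ n → (4 + n) * f n ≤ (1 + n) * f (1 + n)) (sym (+-suc₂ d)) (growth-ratio f mono L (d + 268) (slow-doubling f (d + 268)
    (slow (d + 268) (+-monoʳ-≤ 2 (≤-trans (≤ᵇ⇒≤ 121 268 _) (m≤n+m 268 d))) (+-monoʳ-< d (≤ᵇ⇒≤ 269 270 _)))))) growth
  where
  +-suc₂ : ∀ d → d + 270 ≡ 2 + (d + 268)
  +-suc₂ zero = refl
  +-suc₂ (suc d) = cong suc (+-suc₂ d)
  slow′ : ∀ k → 122 < 2 + k → k < suc d + 270 → Slow f k
  slow′ k p q with m≤n⇒m<n∨m≡n (s≤s⁻¹ q)
  ... | inj₁ r = slow k p r
  ... | inj₂ refl = slow-step f 764 1000 122 (d + 270) (s≤s z≤n) L slow growth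

-- The bound for large moduli

over-1 : ∀ n → over 1 (suc n) ≡ 2
over-1 n = sym (step-unique 0 {over 0} {g} g-eq (suc n))
  where
  g : ℕ → ℕ
  g zero = 1
  g (suc _) = 2
  g-eq : g ≐ over 0 ∔ sh 1 (over 0) ∔ sh 1 g
  g-eq 0 = refl
  g-eq 1 = refl
  g-eq (suc (suc n)) = refl

over-monotone : ∀ m → Monotone (over (suc m))
over-monotone zero zero = subst (1 ≤_) (sym (over-1 0)) (s≤s z≤n)
over-monotone zero (suc n) = ≤-reflexive (trans (over-1 n) (sym (over-1 (suc n))))
over-monotone (suc m) = step-monotone (suc m) (over (suc m)) (over-monotone m)

p̄-monotone : Monotone p̄
p̄-monotone n = subst (_≤ p̄ (suc n)) (over-stable (suc n) n (n≤1+n n)) (over-monotone n n)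

over-level : ∀ {m m′} n → m ≤′ m′ → over m n ≤ over m′ n
over-level n ≤′-refl = ≤-refl
over-level n (≤′-step {m′} p) = ≤-trans (over-level n p) (f≤step m′ (over m′) n)

-- Each size from 3 to 2 + j may be left out or used, which doubles the count. The hypothesis
-- survives the use of s = 3 + j because s² - s ≥ (s - 1)².
over-≥ : ∀ j n → (2 + j) * (2 + j) ≤ n → 2 ^ j ≤ over (2 + j) n
over-≥ zero n h = ≤-trans (pos n) (over-level {1} {2} n (≤⇒≤′ (s≤s z≤n)))
  where
  pos : ∀ n → 1 ≤ over 1 n
  pos zero = s≤s z≤n
  pos (suc n) = subst (1 ≤_) (sym (over-1 n)) (s≤s z≤n)
over-≥ (suc j) n h with m≤n⇒∃[o]m+o≡n (≤-trans (m≤m*n (3 + j) (3 + j)) h)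
... | k , refl = begin
  2 ^ j + (2 ^ j + 0)                                 ≡⟨ cong (2 ^ j +_) (+-identityʳ _) ⟩
  2 ^ j + 2 ^ j                                       ≤⟨ +-mono-≤ (over-≥ j (s + k) (≤-trans h′ (m≤n+m k s))) (over-≥ j k h′) ⟩
  over (2 + j) (s + k) + over (2 + j) k               ≡⟨ cong (over (2 + j) (s + k) +_) (sym (shift-≥ 0 s k (over (2 + j)))) ⟩
  over (2 + j) (s + k) + sh s (over (2 + j)) (s + k)  ≤⟨ m≤m+n _ (sh s (over s) (s + k)) ⟩
  over (2 + j) (s + k) + sh s (over (2 + j)) (s + k) + sh s (over s) (s + k) ≡⟨ sym (step-eq (2 + j) (over (2 + j)) (s + k)) ⟩
  over s (s + k) ∎
  where
  open ≤-Reasoning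
  s = 3 + j
  h′ : (2 + j) * (2 + j) ≤ k
  h′ = ≤-trans (*-monoʳ-≤ (2 + j) (n≤1+n (2 + j))) (+-cancelˡ-≤ s _ _ h)

p̄-≥ : ∀ j n → (2 + j) * (2 + j) ≤ n → 2 ^ j ≤ p̄ n
p̄-≥ j n h = ≤-trans (over-≥ j n h) (over-level n (≤⇒≤′ (≤-trans (m≤m*n (2 + j) (2 + j)) h)))

-- chains j n counts overpartitions of n with parts ≤ 2 + j and no non-overlined part 2.
chains : ℕ → ℕ → ℕ
chains zero = over 1 ∔ sh 2 (over 1)
chains (suc j) = step (3 + j) (chains j)

-- This is the factor 1 / (1 - q²) of the non-overlined parts 2. It is split off at the size 2, and
-- all later steps commute with it.
over-chains : ∀ j → over (2 + j) ≐ chains j ∔ sh 2 (over (2 + j))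
over-chains zero = step-eq 1 (over 1)
over-chains (suc j) n = begin
  step s (over (2 + j)) n                                     ≡⟨ step-cong (2 + j) (over-chains j) n ⟩
  step s (chains j ∔ sh 2 (over (2 + j))) n                   ≡⟨ step-∔ (2 + j) (chains j) (sh 2 (over (2 + j))) n ⟩
  step s (chains j) n + step s (sh 2 (over (2 + j))) n        ≡⟨ cong (step s (chains j) n +_) (step-sh (2 + j) 2 (over (2 + j)) n) ⟩
  step s (chains j) n + sh 2 (over s) n                       ∎
  where
  open ≡-Reasoning
  s = 3 + j

p̄-chains : ∀ n → p̄ n ≡ chains n n + sh 2 p̄ n
p̄-chains n = trans (sym (over-stable (2 + n) n (m≤n+m n 2))) (trans (over-chains n n)
  (cong (chains n n +_) (shift-rel _≡_ refl 1 n (λ k k<n → over-stable (2 + n) k (≤-trans (<⇒≤ k<n) (m≤n+m n 2))))))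

chains-monotone : ∀ j → Monotone (chains j)
chains-monotone zero n = +-mono-≤ (over-monotone 0 n) (sh-monotone 1 (over 1) n (λ k _ → over-monotone 0 k))
chains-monotone (suc j) = step-monotone (2 + j) (chains j) (chains-monotone j)

chains-0-≤ : ∀ n → chains 0 n ≤ 4
chains-0-≤ n = +-mono-≤ (bound n) (shift-rel {B = ℕ} (λ x _ → x ≤ 2) {y = 0} z≤n 1 {g = id} n (λ k _ → bound k))
  where
  bound : ∀ n → over 1 n ≤ 2
  bound zero = s≤s z≤n
  bound (suc n) = ≤-reflexive (over-1 n)

shiftSum : ℕ → ℕ → (ℕ → ℕ) → ℕ → ℕ
shiftSum a zero g n = 0
shiftSum a (suc j) g n = sh a g n + shiftSum (suc a) j g n

shiftSum-last : ∀ a j g n → shiftSum a (suc j) g n ≡ shiftSum a j g n + sh (a + j) g n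
shiftSum-last a zero g n = trans (+-identityʳ _) (cong (λ b → sh b g n) (sym (+-identityʳ a)))
shiftSum-last a (suc j) g n = trans (cong (sh a g n +_) (trans (shiftSum-last (suc a) j g n)
  (cong (λ b → shiftSum (suc a) j g n + sh b g n) (sym (+-suc a j))))) (sym (+-assoc (sh a g n) _ _))

shiftSum-cong : ∀ a j {f g} → f ≐ g → shiftSum a j f ≐ shiftSum a j g
shiftSum-cong a zero e n = refl
shiftSum-cong a (suc j) e n = cong₂ _+_ (shift-cong 0 a e n) (shiftSum-cong (suc a) j e n)

shiftSum-∔ : ∀ a j f g → shiftSum a j (f ∔ g) ≐ shiftSum a j f ∔ shiftSum a j g
shiftSum-∔ a zero f g n = refl
shiftSum-∔ a (suc j) f g n = trans (cong₂ _+_ (sh-∔ a f g n) (shiftSum-∔ (suc a) j f g n))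
  (lemma (sh a f n) (sh a g n) (shiftSum (suc a) j f n) (shiftSum (suc a) j g n))
  where
  lemma : ∀ a b c d → a + b + (c + d) ≡ a + c + (b + d)
  lemma = solve-∀

shiftSum-sh : ∀ a j s f → shiftSum a j (sh s f) ≐ sh s (shiftSum a j f)
shiftSum-sh a zero s f n = sym (shift-0 s n)
  where
  shift-0 : ∀ s n → sh s (λ _ → 0) n ≡ 0
  shift-0 s n = shift-rel₀ {A = ℕ} {B = ℕ} (λ x _ → x ≡ 0) {y = 0} refl s {g = id} n (λ _ _ → refl)
shiftSum-sh a (suc j) s f n = trans (cong₂ _+_ (shift-comm 0 a s f n) (shiftSum-sh (suc a) j s f n)) (sym (sh-∔ s (sh a f) _ n))

-- Bounds D times the number of overpartitions of any n ≤ N with parts ≤ 2 + j, no non-overlined 2 and fewer than D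
-- distinct part sizes ≥ 3.
excess : ℕ → ℕ → ℕ → ℕ
excess zero j N = 0
excess (suc D) zero N = suc D * 4
excess (suc D) (suc j) N = excess (suc D) j N + 2 * N * excess D j N

-- Double counting of pairs of an overpartition and a size ≥ 3 occurring in it. The induction adds
-- the size s = 3 + j: overpartitions without s must find all their sizes below s, those with s one
-- fewer.
chains-distinctParts : ∀ D j N n → n ≤ N → D * chains j n ≤ 2 * shiftSum 3 j (chains j) n + excess D j N
chains-distinctParts zero j N n p = z≤n
chains-distinctParts (suc D) zero N n p = *-monoʳ-≤ (suc D) (chains-0-≤ n)
chains-distinctParts (suc D) (suc j) N n p = begin
  suc D * g n                                     ≡⟨ cong (suc D *_) (g-eq n) ⟩
  suc D * (f n + h n)                             ≡⟨ lemma₁ D (f n) (h n) ⟩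
  suc D * f n + D * h n + h n
    ≤⟨ +-mono-≤ (+-mono-≤ (chains-distinctParts (suc D) j N n p) (h-distinctParts n p)) (h-≤ n) ⟩
  2 * shiftSum 3 j f n + E′ + (2 * shiftSum 3 j h n + 2 * n * E) + 2 * sh s g n
    ≡⟨ lemma₂ (shiftSum 3 j f n) E′ (shiftSum 3 j h n) (2 * n * E) (sh s g n) ⟩
  2 * (shiftSum 3 j f n + shiftSum 3 j h n + sh s g n) + (E′ + 2 * n * E)
    ≡⟨ cong (λ x → 2 * (x + sh s g n) + (E′ + 2 * n * E)) (sym (trans (shiftSum-cong 3 j g-eq n) (shiftSum-∔ 3 j f h n))) ⟩
  2 * (shiftSum 3 j g n + sh s g n) + (E′ + 2 * n * E)
    ≡⟨ cong (λ x → 2 * x + (E′ + 2 * n * E)) (sym (shiftSum-last 3 j g n)) ⟩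
  2 * shiftSum 3 (suc j) g n + (E′ + 2 * n * E)
    ≤⟨ +-monoʳ-≤ (2 * shiftSum 3 (suc j) g n) (+-monoʳ-≤ E′ (*-monoˡ-≤ E (*-monoʳ-≤ 2 p))) ⟩
  2 * shiftSum 3 (suc j) g n + excess (suc D) (suc j) N ∎
  where
  open ≤-Reasoning
  s = 3 + j
  f = chains j
  g = chains (suc j)
  E = excess D j N
  E′ = excess (suc D) j N
  2f : ℕ → ℕ
  2f = f ∔ f
  -- The members of g in which s occurs, that is 2 q^s f / (1 - q^s).
  h = geo s (sh s 2f)
  h-eq : h ≐ sh s (2f ∔ h)
  h-eq k = trans (geo-eq (2 + j) (sh s 2f) k) (sym (sh-∔ s 2f h k))
  g-eq : g ≐ f ∔ h
  g-eq k = sym (step-unique (2 + j) {f} {f ∔ h} (λ k → trans (cong (f k +_) (trans (h-eq k) (trans (sh-∔ s 2f h k)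
    (trans (cong (_+ sh s h k) (sh-∔ s f f k)) (+-assoc (sh s f k) (sh s f k) (sh s h k))))))
    (trans (sym (+-assoc (f k) (sh s f k) _)) (cong (f k + sh s f k +_) (sym (sh-∔ s f h k))))) k)
  -- Taking away one copy of s is at most two-to-one: only the last copy can have been overlined or
  -- not with the same result.
  h-≤ : ∀ k → h k ≤ 2 * sh s g k
  h-≤ k = begin
    h k                              ≡⟨ trans (h-eq k) (trans (sh-∔ s 2f h k) (cong (_+ sh s h k) (sh-∔ s f f k))) ⟩
    sh s f k + sh s f k + sh s h k   ≤⟨ m≤m+n _ (sh s h k) ⟩
    sh s f k + sh s f k + sh s h k + sh s h k ≡⟨ lemma₃ (sh s f k) (sh s h k) ⟩
    2 * (sh s f k + sh s h k)        ≡⟨ cong (2 *_) (sym (trans (shift-cong 0 s g-eq k) (sh-∔ s f h k))) ⟩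
    2 * sh s g k                     ∎
    where
    lemma₃ : ∀ a b → a + a + b + b ≡ 2 * (a + b)
    lemma₃ = solve-∀
  lemma₁ : ∀ D a b → suc D * (a + b) ≡ suc D * a + D * b + b
  lemma₁ = solve-∀
  lemma₂ : ∀ a e b x c → 2 * a + e + (2 * b + x) + 2 * c ≡ 2 * (a + b + c) + (e + x)
  lemma₂ = solve-∀
  -- Here only sizes below s are counted. Unrolling h = q^s (2f + h) costs 2E for each copy of s,
  -- and there are at most k copies.
  h-distinctParts : ∀ k → k ≤ N → D * h k ≤ 2 * shiftSum 3 j h k + 2 * k * E
  h-distinctParts = <-rec _ go
    where
    lemma₄ : ∀ a b k E → 2 * a + E + (2 * a + E) + (2 * b + 2 * k * E) ≡ 2 * (a + a + b) + 2 * (1 + k) * E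
    lemma₄ = solve-∀
    go : ∀ k → (∀ {i} → i < k → i ≤ N → D * h i ≤ 2 * shiftSum 3 j h i + 2 * i * E) → k ≤ N → D * h k ≤ 2 * shiftSum 3 j h k + 2 * k * E
    go k rec k≤N with k <? s
    ... | yes k<s = ≤-trans (≤-reflexive (trans (cong (D *_) (trans (h-eq k) (shift-< 0 _ k<s))) (*-zeroʳ D))) z≤n
    ... | no k≮s with m≤n⇒∃[o]m+o≡n (≮⇒≥ k≮s)
    ... | i , refl = begin
      D * h (s + i)                                  ≡⟨ cong (D *_) (trans (h-eq (s + i)) (shift-≥ 0 s i (2f ∔ h))) ⟩
      D * (f i + f i + h i)                          ≡⟨ lemma₅ D (f i) (h i) ⟩
      D * f i + D * f i + D * h i
        ≤⟨ +-mono-≤ (+-mono-≤ f-bound f-bound) (rec (s≤s (m≤n+m i (2 + j))) i≤N) ⟩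
      2 * shiftSum 3 j f i + E + (2 * shiftSum 3 j f i + E) + (2 * shiftSum 3 j h i + 2 * i * E)
        ≡⟨ lemma₄ (shiftSum 3 j f i) (shiftSum 3 j h i) i E ⟩
      2 * (shiftSum 3 j f i + shiftSum 3 j f i + shiftSum 3 j h i) + 2 * (1 + i) * E
        ≤⟨ +-monoʳ-≤ (2 * (shiftSum 3 j f i + shiftSum 3 j f i + shiftSum 3 j h i)) (*-monoˡ-≤ E (*-monoʳ-≤ 2 (s≤s (m≤n+m i (2 + j))))) ⟩
      2 * (shiftSum 3 j f i + shiftSum 3 j f i + shiftSum 3 j h i) + 2 * (s + i) * E
        ≡⟨ cong (λ x → 2 * x + 2 * (s + i) * E) (sym shiftSum-h) ⟩
      2 * shiftSum 3 j h (s + i) + 2 * (s + i) * E   ∎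
      where
      i≤N = ≤-trans (m≤n+m i s) k≤N
      f-bound = chains-distinctParts D j N i i≤N
      lemma₅ : ∀ D a b → D * (a + a + b) ≡ D * a + D * a + D * b
      lemma₅ = solve-∀
      shiftSum-h : shiftSum 3 j h (s + i) ≡ shiftSum 3 j f i + shiftSum 3 j f i + shiftSum 3 j h i
      shiftSum-h = trans (shiftSum-cong 3 j h-eq (s + i)) (trans (shiftSum-sh 3 j s (2f ∔ h) (s + i))
        (trans (shift-≥ 0 s i (shiftSum 3 j (2f ∔ h))) (trans (shiftSum-∔ 3 j 2f h i) (cong (_+ shiftSum 3 j h i) (shiftSum-∔ 3 j f f i)))))

sh-suc-≤ : ∀ a {c} → Monotone c → ∀ n → sh (suc a) c n ≤ sh a c n
sh-suc-≤ a mono zero = z≤n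
sh-suc-≤ zero mono (suc n) = mono n
sh-suc-≤ (suc a) mono (suc n) = sh-suc-≤ a mono n

-- The terms are paired: by monotonicity the values of c at n-a-1 and n-a-2 are at most that at n-a,
-- and the values of c at n-a, n-a-2, ... add up to that of P at n-a, because P = c / (1 - q²).
shiftSum-≤ : ∀ {c P} → Monotone c → P ≐ c ∔ sh 2 P → ∀ j a n → shiftSum (suc a) j c n ≤ 2 * sh a P n
shiftSum-≤ {c} {P} mono e j a n = go j a
  where
  open ≤-Reasoning
  split : ∀ a → sh a P n ≡ sh a c n + sh (2 + a) P n
  split a = trans (shift-cong 0 a e n) (trans (sh-∔ a c (sh 2 P) n) (cong (sh a c n +_)
    (trans (shift-+ 0 a 2 P n) (cong (λ b → sh b P n) (+-comm a 2)))))
  c≤P : ∀ a → sh a c n ≤ sh a P n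
  c≤P a = ≤-trans (m≤m+n _ _) (≤-reflexive (sym (split a)))
  lemma : ∀ x y → x + (x + 2 * y) ≡ 2 * (x + y)
  lemma = solve-∀
  go : ∀ j a → shiftSum (suc a) j c n ≤ 2 * sh a P n
  go zero a = z≤n
  go (suc zero) a = +-mono-≤ (≤-trans (sh-suc-≤ a mono n) (c≤P a)) z≤n
  go (suc (suc j)) a = begin
    sh (1 + a) c n + (sh (2 + a) c n + shiftSum (3 + a) j c n)
      ≤⟨ +-mono-≤ (sh-suc-≤ a mono n) (+-mono-≤ (≤-trans (sh-suc-≤ (1 + a) mono n) (sh-suc-≤ a mono n)) (go j (2 + a))) ⟩
    sh a c n + (sh a c n + 2 * sh (2 + a) P n)          ≡⟨ lemma (sh a c n) (sh (2 + a) P n) ⟩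
    2 * (sh a c n + sh (2 + a) P n)                     ≡⟨ cong (2 *_) (sym (split a)) ⟩
    2 * sh a P n                                        ∎

-- Passing from D to D + 1 sums at most N terms 2N · `excess D`, hence the factor 2N²; the summand 4
-- absorbs the value at j = 0. For fixed D the bound is polynomial in N.
excess-≤ : ∀ D j N → j ≤ N → excess D j N ≤ D * (2 * (N * N) + 4) ^ D
excess-≤ zero j N p = z≤n
excess-≤ (suc D) j N p = begin
  excess (suc D) j N                                     ≤⟨ inner j p ⟩
  suc D * 4 + j * (2 * N * (D * X ^ D))                  ≤⟨ +-monoʳ-≤ (suc D * 4) (*-monoˡ-≤ (2 * N * (D * X ^ D)) p) ⟩
  suc D * 4 + N * (2 * N * (D * X ^ D))                  ≤⟨ +-mono-≤ (*-monoʳ-≤ (suc D) (m≤n*m 4 (X ^ D) {{m^n≢0 X D {{X≢0}}}})) (*-monoʳ-≤ N (*-monoʳ-≤ (2 * N) (*-monoˡ-≤ (X ^ D) (n≤1+n D)))) ⟩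
  suc D * (X ^ D * 4) + N * (2 * N * (suc D * X ^ D))    ≡⟨ lemma (suc D) N (X ^ D) ⟩
  suc D * (X * X ^ D)                                    ∎
  where
  open ≤-Reasoning
  X = 2 * (N * N) + 4
  X≢0 : NonZero X
  X≢0 = >-nonZero (≤-trans (s≤s z≤n) (m≤n+m 4 (2 * (N * N))))
  lemma : ∀ d N y → d * (y * 4) + N * (2 * N * (d * y)) ≡ d * ((2 * (N * N) + 4) * y)
  lemma = solve-∀
  inner : ∀ j → j ≤ N → excess (suc D) j N ≤ suc D * 4 + j * (2 * N * (D * X ^ D))
  inner zero p = m≤m+n _ 0
  inner (suc j) p = ≤-trans (+-mono-≤ (inner j (<⇒≤ p)) (*-monoʳ-≤ (2 * N) (excess-≤ D j N (<⇒≤ p))))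
    (≤-reflexive (lemma′ (suc D * 4) j (2 * N * (D * X ^ D))))
    where
    lemma′ : ∀ a j b → a + j * b + b ≡ a + suc j * b
    lemma′ = solve-∀

-- The 4 is a 2 for the choice of overlining in `chains-distinctParts` times the 2 of the pairing in
-- `shiftSum-≤`.
chains-≤ : ∀ D n → D * chains n n ≤ 4 * p̄ n + D * (2 * (n * n) + 4) ^ D
chains-≤ D n = ≤-trans (chains-distinctParts D n n n ≤-refl) (+-mono-≤
  (≤-trans (*-monoʳ-≤ 2 (≤-trans (shiftSum-≤ (chains-monotone n) (over-chains n) n 2 n) (*-monoʳ-≤ 2 sh-≤)))
    (≤-reflexive (sym (*-assoc 2 2 (p̄ n)))))
  (excess-≤ D n n ≤-refl))
  where
  sh-≤ : sh 2 (over (2 + n)) n ≤ p̄ n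
  sh-≤ = ≤-trans (m≤n+m _ (chains n n)) (≤-reflexive (trans (sym (over-chains n n)) (over-stable (2 + n) n (m≤n+m n 2))))

-- Superpolynomial growth of p̄ beyond the threshold

^-square : ∀ t e → t ^ e * t ^ e ≡ t ^ (e * 2)
^-square t e = trans (sym (^-distribˡ-+-* t e e)) (cong (t ^_) (trans (cong (e +_) (sym (+-identityʳ e))) (*-comm 2 e)))

^-distribʳ-* : ∀ a b n → (a * b) ^ n ≡ a ^ n * b ^ n
^-distribʳ-* a b zero = refl
^-distribʳ-* a b (suc n) = trans (cong (a * b *_) (^-distribʳ-* a b n)) (lemma a b (a ^ n) (b ^ n))
  where
  lemma : ∀ a b x y → a * b * (x * y) ≡ a * x * (b * y)
  lemma = solve-∀

-- A partial exponential sum of length 1 is its constant term and reduces to the same expression at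
-- every argument; stated at `0ℚᵘ`, it accepts the hypothesis for k = 1 as it stands.
≤/1-injective : ∀ m n → ((ℤ.+ m) ℚ./ 1) ℚ.* expPartial ℚ.0ℚᵘ 1 ℚ.≤ (ℤ.+ n) ℚ./ 1 → m ≤ n
≤/1-injective m n (*≤* h) = ℤP.drop‿+≤+ (subst₂ ℤ._≤_ (trans (ℤP.*-identityʳ _) (ℤP.*-identityʳ (ℤ.+ m))) (ℤP.*-identityʳ (ℤ.+ n)) h)

atLeastMc-≥ : ∀ c n → AtLeastMc c n → (c * 4) ^ 20 ≤ n
atLeastMc-≥ c n h = begin
  (c * 4) ^ 20          ≡⟨ ^-distribʳ-* c 4 20 ⟩
  -- 4^20 is about 1.1 · 10^12, below the factor 1.691 · 10^13.
  c ^ 20 * 4 ^ 20       ≤⟨ *-monoʳ-≤ (c ^ 20) (≤ᵇ⇒≤ (4 ^ 20) (1691 * 10 ^ 10) _) ⟩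
  c ^ 20 * (1691 * 10 ^ 10) ≡⟨ *-comm (c ^ 20) (1691 * 10 ^ 10) ⟩
  1691 * 10 ^ 10 * c ^ 20   ≤⟨ ≤/1-injective (1691 * 10 ^ 10 * c ^ 20) n (h 1) ⟩
  n                         ∎
  where open ≤-Reasoning

integer-root : ∀ e .{{_ : NonZero e}} n → ∃[ t ] (t ^ e ≤ n × n < suc t ^ e)
integer-root e@(suc _) zero = 0 , z≤n , m^n>0 1 e
integer-root e (suc n) with integer-root e n
... | t , lo , hi with suc n <? suc t ^ e
...   | yes hi′ = t , m≤n⇒m≤1+n lo , hi′
...   | no ≮ = suc t , ≮⇒≥ ≮ , ≤-<-trans hi (^-monoˡ-< e (n<1+n (suc t)))

n<2^n : ∀ n → n < 2 ^ n
n<2^n zero = s≤s z≤n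
n<2^n (suc n) = ≤-trans (+-mono-≤ (m^n>0 2 n) (n<2^n n)) (+-monoʳ-≤ (2 ^ n) (≤-reflexive (sym (+-identityʳ (2 ^ n)))))

-- The comparison of exponents of 2 needed in `p̄-superpolynomial-root`: 3 + t is 1 + t from the
-- factor 2^(t+1) and 2 from j = t^10 - 2. The bound 24 is 4c for c = 6.
^10-≥ : ∀ t → 24 ≤ t → 3 + t + (2 + t * 40) * (t * 4) ≤ t ^ 10
^10-≥ t h = begin
  3 + t + (2 + t * 40) * (t * 4)       ≡⟨ lemma t ⟩
  3 + t * 9 + t * t * 160              ≤⟨ +-monoˡ-≤ (t * t * 160) (+-mono-≤ (≤-trans (≤ᵇ⇒≤ 3 576 _) (*-mono-≤ h h)) (*-monoʳ-≤ t (≤-trans (≤ᵇ⇒≤ 9 24 _) h))) ⟩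
  t * t + t * t + t * t * 160          ≡⟨ lemma′ (t * t) ⟩
  t * t * 162                          ≤⟨ *-monoʳ-≤ (t * t) (≤-trans (≤ᵇ⇒≤ 162 (24 ^ 8) _) (^-monoˡ-≤ 8 h)) ⟩
  t * t * t ^ 8                        ≡⟨ *-assoc t t (t ^ 8) ⟩
  t ^ 10                               ∎
  where
  open ≤-Reasoning
  lemma : ∀ t → 3 + t + (2 + t * 40) * (t * 4) ≡ 3 + t * 9 + t * t * 160
  lemma = solve-∀
  lemma′ : ∀ a → a + a + a * 160 ≡ a * 162
  lemma′ = solve-∀

root-≤ : ∀ e a n t → a ^ e ≤ n → n < suc t ^ e → a ≤ t
root-≤ e a n t lo hi = s≤s⁻¹ (≰⇒> (λ p → <⇒≱ hi (≤-trans (^-monoˡ-≤ e p) lo)))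

root-≤-2^ : ∀ e n t → n < suc t ^ e → n ≤ 2 ^ (t * e)
root-≤-2^ e n t hi = ≤-trans (<⇒≤ hi) (≤-trans (^-monoˡ-≤ e (n<2^n t)) (≤-reflexive (^-*-assoc 2 t e)))

-- For t the integer 20th root of n, the left side is below 2 to a quadratic polynomial in t, while
-- t^20 ≤ n lets `p̄-≥` give 2^(t^10 - 2).
p̄-superpolynomial-root : ∀ c n t j → 24 ≤ t → c * 4 ≤ t → n ≤ 2 ^ (t * 20) → 2 + j ≡ t ^ 10 → (2 + j) * (2 + j) ≤ n →
  8 * c * (2 * (n * n) + 4) ^ (c * 16) < p̄ n
p̄-superpolynomial-root c n t j 24≤t 4c≤t n-≤ 2+j≡t^10 sq = begin-strict
  8 * c * X ^ (c * 16)                          ≡⟨ cong₂ _*_ (*-comm 8 c) (cong (X ^_) (sym (*-assoc c 4 4))) ⟩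
  c * 8 * X ^ (c * 4 * 4)                       ≡⟨ cong (_* X ^ (c * 4 * 4)) (sym (*-assoc c 4 2)) ⟩
  c * 4 * 2 * X ^ (c * 4 * 4)                   ≤⟨ *-mono-≤ (*-monoˡ-≤ 2 4c≤t) (^-monoʳ-≤ X {{X≢0}} (*-monoˡ-≤ 4 4c≤t)) ⟩
  t * 2 * X ^ (t * 4)                           ≤⟨ *-monoʳ-≤ (t * 2) (^-monoˡ-≤ (t * 4) X-≤) ⟩
  t * 2 * (2 ^ (2 + t * 40)) ^ (t * 4)          ≡⟨ cong (t * 2 *_) (^-*-assoc 2 (2 + t * 40) (t * 4)) ⟩
  t * 2 * 2 ^ ((2 + t * 40) * (t * 4))          <⟨ *-monoˡ-< (2 ^ ((2 + t * 40) * (t * 4))) {{m^n≢0 2 ((2 + t * 40) * (t * 4))}}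
                                                     (≤-trans (*-monoˡ-< 2 (n<2^n t)) (≤-reflexive (*-comm (2 ^ t) 2))) ⟩
  2 ^ suc t * 2 ^ ((2 + t * 40) * (t * 4))      ≡⟨ sym (^-distribˡ-+-* 2 (suc t) ((2 + t * 40) * (t * 4))) ⟩
  2 ^ (suc t + (2 + t * 40) * (t * 4))          ≤⟨ ^-monoʳ-≤ 2 (+-cancelˡ-≤ 2 _ _ (≤-trans (^10-≥ t 24≤t) (≤-reflexive (sym 2+j≡t^10)))) ⟩
  2 ^ j                                         ≤⟨ p̄-≥ j n sq ⟩
  p̄ n                                          ∎
  where
  open ≤-Reasoning
  X = 2 * (n * n) + 4
  X≢0 : NonZero X
  X≢0 = >-nonZero (≤-trans (s≤s z≤n) (m≤n+m 4 (2 * (n * n))))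
  A = 2 ^ (t * 40)
  X-≤ : X ≤ 2 ^ (2 + t * 40)
  X-≤ = begin
    2 * (n * n) + 4               ≤⟨ +-mono-≤ (*-monoʳ-≤ 2 (*-mono-≤ n-≤ n-≤)) (^-monoʳ-≤ 2 {2} {1 + t * 40} (s≤s (≤-trans (s≤s z≤n) (*-monoˡ-≤ 40 24≤t)))) ⟩
    2 * (2 ^ (t * 20) * 2 ^ (t * 20)) + 2 * A ≡⟨ cong (λ x → 2 * x + 2 * A) (trans (sym (^-distribˡ-+-* 2 (t * 20) (t * 20))) (cong (2 ^_) (sym (*-distribˡ-+ t 20 20)))) ⟩
    2 * A + 2 * A                 ≡⟨ lemma A ⟩
    2 ^ (2 + t * 40)              ∎
    where
    lemma : ∀ a → 2 * a + 2 * a ≡ 2 * (2 * a)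
    lemma = solve-∀

p̄-superpolynomial : ∀ c n → 6 ≤ c → (c * 4) ^ 20 ≤ n → 8 * c * (2 * (n * n) + 4) ^ (c * 16) < p̄ n
p̄-superpolynomial c n 6≤c h = from-root (integer-root 20 n)
  where
  from-root : ∃[ t ] (t ^ 20 ≤ n × n < suc t ^ 20) → 8 * c * (2 * (n * n) + 4) ^ (c * 16) < p̄ n
  from-root (t , lo , hi) = from-root² (m≤n⇒∃[o]m+o≡n
    (≤-trans (≤-trans (s≤s (s≤s z≤n)) (m≤m+n 3 (t + (2 + t * 40) * (t * 4)))) (^10-≥ t 24≤t)))
    where
    4c≤t : c * 4 ≤ t
    4c≤t = root-≤ 20 (c * 4) n t h hi
    24≤t : 24 ≤ t
    24≤t = ≤-trans (*-monoˡ-≤ 4 6≤c) 4c≤t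
    from-root² : ∃[ j ] 2 + j ≡ t ^ 10 → 8 * c * (2 * (n * n) + 4) ^ (c * 16) < p̄ n
    from-root² (j , 2+j≡t^10) = p̄-superpolynomial-root c n t j 24≤t 4c≤t (root-≤-2^ 20 n t hi) 2+j≡t^10
      (≤-trans (≤-reflexive (trans (cong (λ x → x * x) 2+j≡t^10) (^-square t 10))) lo)

-- After multiplication by 8 the factor is D = 16c. Then `chains-≤` accounts for 4 p̄(n), and all
-- polynomial terms together stay below the other 4 p̄(n).
rank-error-small : ∀ c n r → 6 ≤ c → AtLeastMc c n → r ≤ chains n n + (2 * n + 1) → 2 * c * r < p̄ n
rank-error-small c n r 6≤c h r≤ = *-cancelˡ-< 8 (2 * c * r) (p̄ n) (begin-strict
  8 * (2 * c * r)                           ≡⟨ lemma₁ c r ⟩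
  D * r                                     ≤⟨ *-monoʳ-≤ D r≤ ⟩
  D * (chains n n + (2 * n + 1))            ≡⟨ *-distribˡ-+ D (chains n n) (2 * n + 1) ⟩
  D * chains n n + D * (2 * n + 1)          ≤⟨ +-mono-≤ (chains-≤ D n) (*-monoʳ-≤ D (≤-trans (2n+1≤X n) (X≤X^D))) ⟩
  4 * p̄ n + D * X ^ D + D * X ^ D           ≡⟨ lemma₂ (p̄ n) c (X ^ D) ⟩
  4 * p̄ n + 4 * (8 * c * X ^ D)             <⟨ +-monoʳ-< (4 * p̄ n) (*-monoʳ-< 4 (p̄-superpolynomial c n 6≤c (atLeastMc-≥ c n h))) ⟩
  4 * p̄ n + 4 * p̄ n                         ≡⟨ lemma₃ (p̄ n) ⟩
  8 * p̄ n                                   ∎)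
  where
  open ≤-Reasoning
  D = c * 16
  X = 2 * (n * n) + 4
  X≢0 : NonZero X
  X≢0 = >-nonZero (≤-trans (s≤s z≤n) (m≤n+m 4 (2 * (n * n))))
  lemma₁ : ∀ c r → 8 * (2 * c * r) ≡ c * 16 * r
  lemma₁ = solve-∀
  lemma₂ : ∀ p c y → 4 * p + c * 16 * y + c * 16 * y ≡ 4 * p + 4 * (8 * c * y)
  lemma₂ = solve-∀
  lemma₃ : ∀ p → 4 * p + 4 * p ≡ 8 * p
  lemma₃ = solve-∀
  2n+1≤X : ∀ n → 2 * n + 1 ≤ 2 * (n * n) + 4
  2n+1≤X zero = s≤s z≤n
  2n+1≤X n@(suc _) = +-mono-≤ (*-monoʳ-≤ 2 (m≤m*n n n)) (s≤s z≤n)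
  X≤X^D : X ≤ X ^ D
  X≤X^D = ≤-trans (≤-reflexive (sym (^-identityʳ X))) (^-monoʳ-≤ X {{X≢0}} (*-mono-≤ {1} {c} {1} {16} (≤-trans (s≤s z≤n) 6≤c) (s≤s z≤n)))

-- Enumerating overpartitions

geoList : {A : Set} → (A → A) → ℕ → (ℕ → List A) → ℕ → List A
geoList g = unfold _++_ [] (map g)

stepList : {A : Set} → (A → A) → (A → A) → ℕ → (ℕ → List A) → ℕ → List A
stepList g h m f n = geoList g m f n ++ map h (shift [] m (geoList g m f) n)

geoList-eq : {A : Set} (g : A → A) (m : ℕ) (f : ℕ → List A) (n : ℕ) →
  geoList g (suc m) f n ≡ f n ++ map g (shift [] (suc m) (geoList g (suc m) f) n)
geoList-eq g = unfold-eq _++_ [] (map g)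

length-stepList : {A : Set} (g h : A → A) (m : ℕ) (f : ℕ → List A) → length ∘ stepList g h m f ≐ step m (length ∘ f)
length-stepList g h m f n = trans (length-++ (geoList g m f n)) (cong₂ _+_ (length-geoList n)
  (trans (length-map h (shift [] m (geoList g m f) n)) (trans (shift-hom length [] m (geoList g m f) n) (shift-cong 0 m length-geoList n))))
  where
  length-geoList : length ∘ geoList g m f ≐ geo m (length ∘ f)
  length-geoList = unfold-hom {_⊕_ = _++_} {[]} {map g} {_+_} {id} length (λ xs ys → length-++ xs) (λ xs → length-map g xs) m f

∈-shift : {A : Set} (m : ℕ) (L : ℕ → List A) (n : ℕ) {x : A} → x ∈ shift [] m L n → ∃[ k ] (n ≡ m + k × x ∈ L k)
∈-shift zero L n x∈ = n , refl , x∈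
∈-shift (suc m) L (suc n) x∈ with ∈-shift m L n x∈
... | k , refl , x∈L = k , refl , x∈L

∈-map-shift⁻ : {A : Set} (g : A → A) (m : ℕ) (L : ℕ → List A) (n : ℕ) {x : A} → x ∈ map g (shift [] m L n) →
  ∃[ k ] ∃[ y ] (n ≡ m + k × y ∈ L k × x ≡ g y)
∈-map-shift⁻ g m L n x∈ with ∈-map⁻ g x∈
... | y , y∈ , eq with ∈-shift m L n y∈
... | k , n≡ , y∈L = k , y , n≡ , y∈L , eq

∈-map-shift⁺ : {A : Set} (g : A → A) (m : ℕ) (L : ℕ → List A) (n : ℕ) {y : A} → y ∈ L n → g y ∈ map g (shift [] m L (m + n))
∈-map-shift⁺ g m L n y∈ = ∈-map⁺ g (subst (_ ∈_) (sym (shift-≥ [] m n L)) y∈)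

geoList-ind : {A : Set} (g : A → A) (m : ℕ) (f : ℕ → List A) (P : ℕ → A → Set) →
  (∀ n x → x ∈ f n → P n x) → (∀ n x → P n x → P (suc m + n) (g x)) → ∀ n {x} → x ∈ geoList g (suc m) f n → P n x
geoList-ind g m f P base ind = <-rec _ go
  where
  go : ∀ n → (∀ {k} → k < n → ∀ {x} → x ∈ geoList g (suc m) f k → P k x) → ∀ {x} → x ∈ geoList g (suc m) f n → P n x
  go n rec x∈ with ∈-++⁻ (f n) (subst (_ ∈_) (geoList-eq g m f n) x∈)
  ... | inj₁ x∈f = base n _ x∈f
  ... | inj₂ x∈g with ∈-map-shift⁻ g (suc m) (geoList g (suc m) f) n x∈g
  ... | k , y , refl , y∈ , refl = ind k y (rec (s≤s (m≤n+m k m)) y∈)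

geoList-unique : {A : Set} (g : A → A) (m : ℕ) (f : ℕ → List A) → (∀ {x y} → g x ≡ g y → x ≡ y) →
  (∀ n y → g y ∈ f n → ⊥) → (∀ n → Unique (f n)) → ∀ n → Unique (geoList g (suc m) f n)
geoList-unique g m f inj dis uf = <-rec _ λ n rec → subst Unique (sym (geoList-eq g m f n))
  (Unique.++⁺ (uf n) (Unique.map⁺ inj (shift-rel {B = ℕ} (λ xs _ → Unique xs) {y = 0} [] m {g = id} n (λ k → rec {k})))
    (λ { (x∈f , x∈g) → disjoint n x∈f x∈g }))
  where
  disjoint : ∀ n {x} → x ∈ f n → x ∈ map g (shift [] (suc m) (geoList g (suc m) f) n) → ⊥
  disjoint n x∈f x∈g with ∈-map⁻ g x∈g
  ... | y , _ , refl = dis n y x∈f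

f⊆geoList : {A : Set} (g : A → A) (m : ℕ) (f : ℕ → List A) (n : ℕ) {x : A} → x ∈ f n → x ∈ geoList g (suc m) f n
f⊆geoList g m f n x∈ = subst (_ ∈_) (sym (geoList-eq g m f n)) (∈-++⁺ˡ x∈)

map⊆geoList : {A : Set} (g : A → A) (m : ℕ) (f : ℕ → List A) (n : ℕ) {x : A} → x ∈ geoList g (suc m) f n → g x ∈ geoList g (suc m) f (suc m + n)
map⊆geoList g m f n x∈ = subst (_ ∈_) (sym (geoList-eq g m f (suc m + n)))
  (∈-++⁺ʳ (f (suc m + n)) (∈-map-shift⁺ g (suc m) (geoList g (suc m) f) n x∈))

-- For each size the non-overlined copies go in front first, then at most one overlined copy. This
-- is the canonical order, so no overpartition arises twice.
overs : ℕ → ℕ → List (List Entry)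
overs zero zero = [] ∷ []
overs zero (suc n) = []
overs (suc m) = stepList ((suc m , false) ∷_) ((suc m , true) ∷_) (suc m) (overs m)

length-overs : ∀ m n → length (overs m n) ≡ over m n
length-overs zero zero = refl
length-overs zero (suc n) = refl
length-overs (suc m) n = trans (length-stepList _ _ (suc m) (overs m) n) (step-cong m (length-overs m) n)

Bounded : ℕ → List Entry → Set
Bounded m = All (λ e → 1 ≤ proj₁ e × proj₁ e ≤ m)

OverpartitionUpTo : ℕ → ℕ → List Entry → Set
OverpartitionUpTo m n λs = Bounded m λs × Linked Next λs × sum (parts λs) ≡ n

-- The flag true is arbitrary: Next ignores the flag of its first argument.
Below : ℕ → List Entry → Set
Below p λs = Linked Next ((p , true) ∷ λs)

below-flag : ∀ {p b λs} b′ → Linked Next ((p , b) ∷ λs) → Linked Next ((p , b′) ∷ λs)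
below-flag b′ [-] = [-]
below-flag b′ (r ∷ rs) = r ∷ rs

bounded-below : ∀ {m λs} → Bounded m λs → Linked Next λs → Below (suc m) λs
bounded-below [] _ = [-]
bounded-below ((_ , q≤m) ∷ _) l = inj₁ (s≤s q≤m) ∷ l

bounded-suc : ∀ {m λs} → Bounded m λs → Bounded (suc m) λs
bounded-suc = All.map (λ { (p , q) → p , m≤n⇒m≤1+n q })

cons-upTo : ∀ {m n λs} b → OverpartitionUpTo (suc m) n λs → Below (suc m) λs → OverpartitionUpTo (suc m) (suc m + n) ((suc m , b) ∷ λs)
cons-upTo {m} b (bd , _ , eq) bl = (s≤s z≤n , ≤-refl) ∷ bd , below-flag b bl , cong (suc m +_) eq

overs-sound : ∀ m n {λs} → λs ∈ overs m n → OverpartitionUpTo m n λs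
-- The conclusion `Below` records that no overlined part of the current size is present yet, so that
-- one may still be put in front.
geoOvers-sound : ∀ m n {λs} → λs ∈ geoList ((suc m , false) ∷_) (suc m) (overs m) n → OverpartitionUpTo (suc m) n λs × Below (suc m) λs
overs-sound zero zero (here refl) = [] , [] , refl
overs-sound (suc m) n x∈ with ∈-++⁻ (geoList ((suc m , false) ∷_) (suc m) (overs m) n) x∈
... | inj₁ x∈G = proj₁ (geoOvers-sound m n x∈G)
... | inj₂ x∈H with ∈-map-shift⁻ ((suc m , true) ∷_) (suc m) (geoList ((suc m , false) ∷_) (suc m) (overs m)) n x∈H
... | k , y , refl , y∈ , refl with geoOvers-sound m k y∈
... | up , bl = cons-upTo true up bl
geoOvers-sound m n = geoList-ind ((suc m , false) ∷_) m (overs m) (λ n λs → OverpartitionUpTo (suc m) n λs × Below (suc m) λs)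
  (λ n x x∈ → let (bd , l , eq) = overs-sound m n x∈ in (bounded-suc bd , l , eq) , bounded-below bd l)
  (λ n x (up , bl) → cons-upTo false up bl , inj₂ (refl , refl) ∷ below-flag false bl) n

head-bounds : ∀ {q b λs} → Linked Next ((q , b) ∷ λs) → All (λ e → proj₁ e ≤ q) λs
head-bounds [-] = []
head-bounds (inj₁ p<q ∷ l) = <⇒≤ p<q ∷ All.map (λ r≤p → ≤-trans r≤p (<⇒≤ p<q)) (head-bounds l)
head-bounds (inj₂ (refl , _) ∷ l) = ≤-refl ∷ head-bounds l

restrict : ∀ {m q b λs n} → q ≤ m → OverpartitionUpTo (suc m) n ((q , b) ∷ λs) → OverpartitionUpTo m n ((q , b) ∷ λs)
restrict q≤m ((p , _) ∷ bd , l , eq) =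
  (p , q≤m) ∷ All.zipWith (λ { ((r , _) , s) → r , ≤-trans s q≤m }) (bd , head-bounds l) , l , eq

overs-complete : ∀ m n λs → OverpartitionUpTo m n λs → λs ∈ overs m n
geoOvers-complete : ∀ m n λs → OverpartitionUpTo (suc m) n λs → Below (suc m) λs → λs ∈ geoList ((suc m , false) ∷_) (suc m) (overs m) n
overs-complete zero n [] (_ , _ , refl) = here refl
overs-complete zero n ((q , b) ∷ λs) ((1≤q , q≤0) ∷ _ , _) = ⊥-elim (<⇒≱ 1≤q q≤0)
overs-complete (suc m) n [] up = ∈-++⁺ˡ (geoOvers-complete m n [] up [-])
overs-complete (suc m) n ((q , b) ∷ λs) up@((1≤q , q≤sm) ∷ bd , l , eq) with m≤n⇒m<n∨m≡n q≤sm
... | inj₁ q<sm = ∈-++⁺ˡ (geoOvers-complete m n _ up (inj₁ q<sm ∷ l))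
overs-complete (suc m) n ((q , false) ∷ λs) up@((1≤q , q≤sm) ∷ bd , l , eq) | inj₂ refl =
  ∈-++⁺ˡ (geoOvers-complete m n _ up (inj₂ (refl , refl) ∷ l))
overs-complete (suc m) _ ((q , true) ∷ λs) ((1≤q , q≤sm) ∷ bd , l , refl) | inj₂ refl =
  ∈-++⁺ʳ (geoList ((suc m , false) ∷_) (suc m) (overs m) (suc m + sum (parts λs)))
    (∈-map-shift⁺ ((suc m , true) ∷_) (suc m) (geoList ((suc m , false) ∷_) (suc m) (overs m)) (sum (parts λs))
      (geoOvers-complete m (sum (parts λs)) λs (bd , Linked.tail l , refl) l))
geoOvers-complete m n [] (_ , _ , refl) _ = f⊆geoList ((suc m , false) ∷_) m (overs m) 0 (overs-complete m 0 [] ([] , [] , refl))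
geoOvers-complete m n ((q , b) ∷ λs) up@((1≤q , q≤sm) ∷ bd , l , eq) (r ∷ _) with m≤n⇒m<n∨m≡n q≤sm
... | inj₁ (s≤s q≤m) = f⊆geoList _ m (overs m) n (overs-complete m n _ (restrict q≤m up))
geoOvers-complete m _ ((q , b) ∷ λs) ((1≤q , q≤sm) ∷ bd , l , refl) (inj₁ q<q ∷ _) | inj₂ refl = ⊥-elim (<-irrefl refl q<q)
geoOvers-complete m _ ((q , b) ∷ λs) ((1≤q , q≤sm) ∷ bd , l , refl) (inj₂ (_ , refl) ∷ _) | inj₂ refl =
  map⊆geoList ((suc m , false) ∷_) m (overs m) (sum (parts λs))
    (geoOvers-complete m (sum (parts λs)) λs (bd , Linked.tail l , refl) (below-flag true l))

overs-unique : ∀ m n → Unique (overs m n)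
overs-unique zero zero = [] ∷ []
overs-unique zero (suc n) = []
overs-unique (suc m) n = Unique.++⁺ (G-unique n)
  (Unique.map⁺ ∷-injectiveʳ (shift-rel {B = ℕ} (λ xs _ → Unique xs) {y = 0} [] m {g = id} n (λ k _ → G-unique k)))
  (λ { (x∈G , x∈H) → disjoint x∈G x∈H })
  where
  G = geoList ((suc m , false) ∷_) (suc m) (overs m)
  G-unique : ∀ k → Unique (G k)
  G-unique = geoList-unique ((suc m , false) ∷_) m (overs m) ∷-injectiveʳ
    (λ k y y∈ → 1+n≰n (proj₂ (All.head (proj₁ (overs-sound m k y∈))))) (overs-unique m)
  disjoint : ∀ {x} → x ∈ G n → x ∈ map ((suc m , true) ∷_) (shift [] (suc m) G n) → ⊥
  disjoint x∈G x∈H with ∈-map⁻ _ x∈H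
  ... | y , _ , refl with proj₂ (geoOvers-sound m n x∈G)
  ... | inj₁ q<q ∷ _ = <-irrefl refl q<q

-- Agreement of the enumeration with the filtered search space

candidates-complete : ∀ n {λs} → IsOverpartitionOf n λs → λs ∈ candidates n
candidates-complete n {λs} (pos , l , eq) = ∈-concatMap⁺ (listsOfLength es) (lose (∈-upTo⁺ (s≤s (≤-trans (length-≤ λs pos) (≤-reflexive eq))))
  (lists λs (entries λs pos (≤-reflexive eq))))
  where
  es = cartesianProduct (applyUpTo suc n) (true ∷ false ∷ [])
  length-≤ : ∀ λs → All (λ e → 1 ≤ proj₁ e) λs → length λs ≤ sum (parts λs)
  length-≤ [] [] = z≤n
  length-≤ (x ∷ λs) (p ∷ ps) = +-mono-≤ p (length-≤ λs ps)
  flag∈ : ∀ b → b ∈ true ∷ false ∷ []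
  flag∈ true = here refl
  flag∈ false = there (here refl)
  entries : ∀ λs → All (λ e → 1 ≤ proj₁ e) λs → sum (parts λs) ≤ n → All (_∈ es) λs
  entries [] [] h = []
  entries ((suc q , b) ∷ λs) (_ ∷ ps) h =
    ∈-cartesianProduct⁺ (∈-applyUpTo⁺ suc (m+n≤o⇒m≤o (suc q) h)) (flag∈ b) ∷ entries λs ps (m+n≤o⇒n≤o (suc q) h)
  lists : ∀ λs → All (_∈ es) λs → λs ∈ listsOfLength es (length λs)
  lists [] [] = here refl
  lists (x ∷ λs) (p ∷ ps) = ∈-concatMap⁺ (λ x → map (x ∷_) (listsOfLength es (length λs))) (lose p (∈-map⁺ (x ∷_) (lists λs ps)))

listsOfLength-length : {A : Set} (xs : List A) (l : ℕ) {ys : List A} → ys ∈ listsOfLength xs l → length ys ≡ l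
listsOfLength-length xs zero (here refl) = refl
listsOfLength-length xs (suc l) ys∈ with find (∈-concatMap⁻ _ {xs = xs} ys∈)
... | x , _ , ys∈′ with ∈-map⁻ (x ∷_) ys∈′
... | zs , zs∈ , refl = cong suc (listsOfLength-length xs l zs∈)

listsOfLength-unique : {A : Set} (xs : List A) (l : ℕ) → Unique xs → Unique (listsOfLength xs l)
listsOfLength-unique xs zero u = [] ∷ []
listsOfLength-unique {A} xs (suc l) u = Unique.concat⁺ (All.map⁺ (All.universal (λ x → Unique.map⁺ ∷-injectiveʳ (listsOfLength-unique xs l u)) xs))
  (AllPairs.map⁺ (AllPairs.map (λ x≢y → λ { (v∈ , v∈′) → heads x≢y v∈ v∈′ }) u))
  where
  heads : ∀ {x y v} → x ≢ y → v ∈ map (x ∷_) (listsOfLength xs l) → v ∈ map (y ∷_) (listsOfLength xs l) → ⊥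
  heads x≢y v∈ v∈′ with ∈-map⁻ _ v∈ | ∈-map⁻ _ v∈′
  ... | _ , _ , refl | _ , _ , refl = x≢y refl

candidates-unique : ∀ n → Unique (candidates n)
candidates-unique n = Unique.concat⁺ (All.map⁺ (All.universal (λ l → listsOfLength-unique es l es-unique) (upTo (suc n))))
  (AllPairs.map⁺ (AllPairs.map (λ k≢l → λ { (v∈ , v∈′) → k≢l (trans (sym (listsOfLength-length es _ v∈)) (listsOfLength-length es _ v∈′)) })
    (Unique.upTo⁺ (suc n))))
  where
  es = cartesianProduct (applyUpTo suc n) (true ∷ false ∷ [])
  es-unique : Unique es
  es-unique = Unique.cartesianProduct⁺ (Unique.applyUpTo⁺₁ suc n (λ i<j _ eq → <-irrefl (suc-injective eq) i<j))
    (((λ ()) ∷ []) ∷ [] ∷ [])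

overpartition⇔ : ∀ {m n} → n ≤ m → ∀ {λs} → (IsOverpartitionOf n λs → OverpartitionUpTo m n λs) × (OverpartitionUpTo m n λs → IsOverpartitionOf n λs)
overpartition⇔ {m} {n} n≤m {λs} = (λ (pos , l , eq) → bound λs pos (≤-reflexive eq) , l , eq) , λ (bd , l , eq) → All.map proj₁ bd , l , eq
  where
  bound : ∀ λs → All (λ e → 1 ≤ proj₁ e) λs → sum (parts λs) ≤ n → Bounded m λs
  bound [] [] h = []
  bound ((q , b) ∷ λs) (p ∷ ps) h = (p , ≤-trans (m+n≤o⇒m≤o q h) n≤m) ∷ bound λs ps (m+n≤o⇒n≤o q h)

length-unique : {A : Set} {xs ys : List A} → Unique xs → Unique ys →
  (∀ {x} → x ∈ xs → x ∈ ys) → (∀ {x} → x ∈ ys → x ∈ xs) → length xs ≡ length ys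
length-unique u v f g = ↭.↭-length (∼bag⇒↭ (unique∧set⇒bag u v (mk⇔ f g)))

-- The bound m is left free since the chains enumerate `overs (2 + n) n`.
pbar-overs : ∀ {m n} → n ≤ m → pbar n ≡ length (overs m n)
pbar-overs {m} {n} p = length-unique (Unique.filter⁺ (isOverpartitionOf? n) (candidates-unique n)) (overs-unique m n)
  (λ x∈ → overs-complete m n _ (proj₁ (overpartition⇔ p) (proj₂ (∈-filter⁻ (isOverpartitionOf? n) {xs = candidates n} x∈))))
  (λ x∈ → let o = proj₂ (overpartition⇔ p) (overs-sound m n x∈) in ∈-filter⁺ (isOverpartitionOf? n) (candidates-complete n o) o)

Nbar-overs : ∀ a c {m n} → n ≤ m → Nbar a c n ≡ length (filter (rankCong? a c) (overs m n))
Nbar-overs a c {m} {n} p = length-unique (Unique.filter⁺ both? (candidates-unique n)) (Unique.filter⁺ (rankCong? a c) (overs-unique m n))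
  (λ x∈ → let (o , r) = proj₂ (∈-filter⁻ both? {xs = candidates n} x∈) in
    ∈-filter⁺ (rankCong? a c) (overs-complete m n _ (proj₁ (overpartition⇔ p) o)) r)
  (λ x∈ → let (x∈o , r) = ∈-filter⁻ (rankCong? a c) {xs = overs m n} x∈
              o = proj₂ (overpartition⇔ p) (overs-sound m n x∈o) in
    ∈-filter⁺ both? (candidates-complete n o) (o , r))
  where
  both? = λ λs → isOverpartitionOf? n λs ×-dec rankCong? a c λs

-- Ranks in chains

NextRank : List Entry → List Entry → Set
NextRank λs μs = rank μs ≡ 1ℤ ℤ.+ rank λs

rankCount : ℤ → ℕ → List (List Entry) → ℕ
rankCount a c ch = length (filter (rankCong? a c) ch)

rankCount-hit : ∀ a c λs ch → ℤ.+ c ℤ∣.∣ rank λs ℤ.- a → rankCount a c (λs ∷ ch) ≡ suc (rankCount a c ch)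
rankCount-hit a c λs ch div = cong length (filter-accept (rankCong? a c) (ℤ∣.∣⇒∣ᵤ {ℤ.+ c} {rank λs ℤ.- a} div))

-- A rank in the class as well would make c divide the distance, which lies strictly between 0 and
-- c.
rankCount-miss : ∀ a c λs ch d → suc d < c → ℤ.+ c ℤ∣.∣ rank λs ℤ.- a ℤ.+ ℤ.+ (suc d) → rankCount a c (λs ∷ ch) ≡ rankCount a c ch
rankCount-miss a c λs ch d d<c div = cong length (filter-reject (rankCong? a c) λ h →
  <⇒≱ d<c (ℕ∣.∣⇒≤ (ℤ∣.∣⇒∣ᵤ (ℤ∣.∣m+n∣m⇒∣n {ℤ.+ c} {rank λs ℤ.- a} {ℤ.+ suc d} div (ℤ∣.∣ᵤ⇒∣ {ℤ.+ c} {rank λs ℤ.- a} h)))))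

-- d is the distance from the first rank up to the residue class a, and e is that distance from the rank after the last one.
rankCount-chain : ∀ a c′ λs ch d → let c = suc c′ in Linked NextRank (λs ∷ ch) → d ≤ c′ →
  ℤ.+ c ℤ∣.∣ rank λs ℤ.- a ℤ.+ ℤ.+ d → ∃[ e ] (e ≤ c′ × c * rankCount a c (λs ∷ ch) + d ≡ suc (length ch) + e)
rankCount-chain a c′ λs [] zero lk d≤ div = c′ , ≤-refl ,
  trans (cong (λ x → suc c′ * x + 0) (rankCount-hit a (suc c′) λs [] (subst (ℤ.+ suc c′ ℤ∣.∣_) (ℤP.+-identityʳ _) div))) (lemma c′)
  where
  lemma : ∀ c′ → suc c′ * 1 + 0 ≡ 1 + c′
  lemma = solve-∀
rankCount-chain a c′ λs [] (suc d) lk d≤ div = d , <⇒≤ d≤ ,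
  trans (cong (λ x → suc c′ * x + suc d) (rankCount-miss a (suc c′) λs [] d (s≤s d≤) div)) (cong (_+ suc d) (*-zeroʳ (suc c′)))
rankCount-chain a c′ λs (μs ∷ ch) zero (r ∷ lk) d≤ div = e , e≤ , (begin
  c * rankCount a c (λs ∷ μs ∷ ch) + 0    ≡⟨ cong (λ x → c * x + 0) (rankCount-hit a c λs (μs ∷ ch) (subst (ℤ.+ c ℤ∣.∣_) (ℤP.+-identityʳ _) div)) ⟩
  c * suc (rankCount a c (μs ∷ ch)) + 0   ≡⟨ lemma c′ _ ⟩
  suc (c * rankCount a c (μs ∷ ch) + c′)  ≡⟨ cong suc eq ⟩
  suc (suc (length ch) + e)               ∎)
  where
  open ≡-Reasoning
  c = suc c′
  lemma : ∀ c′ x → suc c′ * suc x + 0 ≡ suc (suc c′ * x + c′)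
  lemma = solve-∀
  shifted : ∀ r a x → r ℤ.- a ℤ.+ 0ℤ ℤ.+ (1ℤ ℤ.+ x) ≡ 1ℤ ℤ.+ r ℤ.- a ℤ.+ x
  shifted = ℤSolver.solve-∀
  -- Just after a hit the rank is one past the class, so the next distance is c - 1.
  next = rankCount-chain a c′ μs ch c′ lk ≤-refl (subst (ℤ.+ c ℤ∣.∣_)
    (trans (shifted (rank λs) a (ℤ.+ c′)) (cong (λ x → x ℤ.- a ℤ.+ ℤ.+ c′) (sym r))) (ℤ∣.∣m∣n⇒∣m+n div ℤ∣.∣-refl))
  e = proj₁ next
  e≤ = proj₁ (proj₂ next)
  eq = proj₂ (proj₂ next)
rankCount-chain a c′ λs (μs ∷ ch) (suc d) (r ∷ lk) d≤ div = e , e≤ , (begin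
  c * rankCount a c (λs ∷ μs ∷ ch) + suc d    ≡⟨ cong (λ x → c * x + suc d) (rankCount-miss a c λs (μs ∷ ch) d (s≤s d≤) div) ⟩
  c * rankCount a c (μs ∷ ch) + suc d         ≡⟨ +-suc _ d ⟩
  suc (c * rankCount a c (μs ∷ ch) + d)       ≡⟨ cong suc eq ⟩
  suc (suc (length ch) + e)                   ∎)
  where
  open ≡-Reasoning
  c = suc c′
  shifted : ∀ r a x → r ℤ.- a ℤ.+ (1ℤ ℤ.+ x) ≡ 1ℤ ℤ.+ r ℤ.- a ℤ.+ x
  shifted = ℤSolver.solve-∀
  next = rankCount-chain a c′ μs ch d lk (<⇒≤ d≤) (subst (ℤ.+ c ℤ∣.∣_)
    (trans (shifted (rank λs) a (ℤ.+ d)) (cong (λ x → x ℤ.- a ℤ.+ ℤ.+ d) (sym r))) div)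
  e = proj₁ next
  e≤ = proj₁ (proj₂ next)
  eq = proj₂ (proj₂ next)

distance : ∀ c′ x → ∃[ d ] (d ≤ c′ × ℤ.+ suc c′ ℤ∣.∣ x ℤ.+ ℤ.+ d)
distance c′ x = (ℤ.- x) ℤ/.%ℕ c , s≤s⁻¹ (ℤ/.n%ℕd<d (ℤ.- x) c) , ℤ∣.divides (ℤ.- q) (begin
  x ℤ.+ r                        ≡⟨ lemma x r ⟩
  r ℤ.- (ℤ.- x)                  ≡⟨ cong (λ y → r ℤ.- y) (ℤ/.a≡a%ℕn+[a/ℕn]*n (ℤ.- x) c) ⟩
  r ℤ.- (r ℤ.+ q ℤ.* ℤ.+ c)      ≡⟨ lemma′ r q (ℤ.+ c) ⟩
  ℤ.- q ℤ.* ℤ.+ c                ∎)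
  where
  open ≡-Reasoning
  c = suc c′
  q = (ℤ.- x) ℤ/./ℕ c
  r = ℤ.+ ((ℤ.- x) ℤ/.%ℕ c)
  lemma : ∀ x r → x ℤ.+ r ≡ r ℤ.- (ℤ.- x)
  lemma = ℤSolver.solve-∀
  lemma′ : ∀ r q c → r ℤ.- (r ℤ.+ q ℤ.* c) ≡ ℤ.- q ℤ.* c
  lemma′ = ℤSolver.solve-∀

-- The deviation is the difference of the two distances e and d, each at most c - 1.
rankCount-bounds : ∀ a c′ ch → let c = suc c′ in Linked NextRank ch →
  c * rankCount a c ch ≤ length ch + c′ × length ch ≤ c * rankCount a c ch + c′
rankCount-bounds a c′ [] lk = ≤-trans (≤-reflexive (*-zeroʳ (suc c′))) z≤n , z≤n
rankCount-bounds a c′ (λs ∷ ch) lk with distance c′ (rank λs ℤ.- a)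
... | d , d≤ , div with rankCount-chain a c′ λs ch d lk d≤ div
... | e , e≤ , eq = ≤-trans (m≤m+n _ d) (≤-trans (≤-reflexive eq) (+-monoʳ-≤ (suc (length ch)) e≤)) ,
  ≤-trans (m≤m+n _ e) (≤-trans (≤-reflexive (sym eq)) (+-monoʳ-≤ (suc c′ * rankCount a (suc c′) (λs ∷ ch)) d≤))

rankCount-concat : ∀ a c′ cs → let c = suc c′ in All (Linked NextRank) cs →
  c * rankCount a c (concat cs) ≤ length (concat cs) + c′ * length cs ×
  length (concat cs) ≤ c * rankCount a c (concat cs) + c′ * length cs
rankCount-concat a c′ [] [] = ≤-trans (≤-reflexive (*-zeroʳ (suc c′))) z≤n , z≤n
rankCount-concat a c′ (ch ∷ cs) (l ∷ ls) with rankCount-bounds a c′ ch l | rankCount-concat a c′ cs ls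
... | up , lo | ups , los = (begin
    c * rankCount a c (ch ++ concat cs)                                   ≡⟨ split ⟩
    c * rankCount a c ch + c * rankCount a c (concat cs)                  ≤⟨ +-mono-≤ up ups ⟩
    length ch + c′ + (length (concat cs) + c′ * length cs)                ≡⟨ lemma (length ch) c′ (length (concat cs)) (length cs) ⟩
    length ch + length (concat cs) + c′ * suc (length cs)                 ≡⟨ cong (_+ c′ * suc (length cs)) (sym (length-++ ch)) ⟩
    length (ch ++ concat cs) + c′ * suc (length cs)                       ∎) , (begin
    length (ch ++ concat cs)                                              ≡⟨ length-++ ch ⟩
    length ch + length (concat cs)                                        ≤⟨ +-mono-≤ lo los ⟩
    c * rankCount a c ch + c′ + (c * rankCount a c (concat cs) + c′ * length cs) ≡⟨ lemma (c * rankCount a c ch) c′ _ (length cs) ⟩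
    c * rankCount a c ch + c * rankCount a c (concat cs) + c′ * suc (length cs)  ≡⟨ cong (_+ c′ * suc (length cs)) (sym split) ⟩
    c * rankCount a c (ch ++ concat cs) + c′ * suc (length cs)            ∎)
  where
  open ≤-Reasoning
  c = suc c′
  lemma : ∀ x c y z → x + c + (y + c * z) ≡ x + y + c * suc z
  lemma = solve-∀
  split : c * rankCount a c (ch ++ concat cs) ≡ c * rankCount a c ch + c * rankCount a c (concat cs)
  split = trans (cong (c *_) (trans (cong length (filter-++ (rankCong? a c) ch (concat cs))) (length-++ (filter (rankCong? a c) ch))))
    (*-distribˡ-+ c (rankCount a c ch) _)

-- Decomposition of the overpartitions into chains

stepList-↭ : {A : Set} (g h : A → A) (m : ℕ) {f f′ : ℕ → List A} → (∀ n → f n ↭ f′ n) →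
  ∀ n → stepList g h (suc m) f n ↭ stepList g h (suc m) f′ n
stepList-↭ g h m {f} {f′} e n = ↭.++⁺ (geoList-↭ n) (↭.map⁺ h (shift-rel _↭_ ↭-refl m n (λ k _ → geoList-↭ k)))
  where
  geoList-↭ : ∀ n → geoList g (suc m) f n ↭ geoList g (suc m) f′ n
  geoList-↭ = <-rec _ λ n rec → ↭-trans (↭-reflexive (geoList-eq g m f n)) (↭-trans
    (↭.++⁺ (e n) (↭.map⁺ g (shift-rel _↭_ ↭-refl m n (λ k → rec {k}))))
    (↭-reflexive (sym (geoList-eq g m f′ n))))

concat-stepList : {A : Set} (g h : A → A) (m : ℕ) (f : ℕ → List (List A)) →
  ∀ n → concat (stepList (map g) (map h) m f n) ≡ stepList g h m (concat ∘ f) n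
concat-stepList g h m f n = trans (sym (concat-++ (geoList (map g) m f n) _)) (cong₂ _++_ (concat-geoList n)
  (trans (concat-map (shift [] m (geoList (map g) m f) n)) (cong (map h)
    (trans (shift-hom concat [] m (geoList (map g) m f) n) (shift-cong [] m concat-geoList n)))))
  where
  concat-geoList : concat ∘ geoList (map g) m f ≐ geoList g m (concat ∘ f)
  concat-geoList = unfold-hom {_⊕_ = _++_} {[]} {map (map g)} {_++_} {map g} concat
    (λ xs ys → sym (concat-++ xs ys)) concat-map m f

-- A chain trades two parts 1 for one part 2 repeatedly, all parts being non-overlined; t k is its all-ones member.
chainTail : (ℕ → List Entry) → ℕ → List (List Entry)
chainTail t 0 = []
chainTail t 1 = []
chainTail t (suc (suc k)) = map ((2 , false) ∷_) (t k ∷ chainTail t k)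

chain : (ℕ → List Entry) → ℕ → List (List Entry)
chain t k = t k ∷ chainTail t k

ones onesOverlined : ℕ → List Entry
ones k = replicate k (1 , false)
onesOverlined k = (1 , true) ∷ ones k

-- An overlined 1 takes no part in the trades and marks a second chain; it uses up weight 1 itself.
onesTwosChains : ℕ → List (List (List Entry))
onesTwosChains zero = chain ones 0 ∷ []
onesTwosChains (suc k) = chain ones (suc k) ∷ chain onesOverlined k ∷ []

-- An overlined 2 stays in front of its whole chain. From size 3 on the recursion is that of
-- `chains`, acting on whole chains.
chainList : ℕ → ℕ → List (List (List Entry))
chainList zero n = onesTwosChains n ++ map (map ((2 , true) ∷_)) (shift [] 2 onesTwosChains n)
chainList (suc j) = stepList (map ((3 + j , false) ∷_)) (map ((3 + j , true) ∷_)) (3 + j) (chainList j)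

length-onesTwosChains : length ∘ onesTwosChains ≐ over 1
length-onesTwosChains zero = refl
length-onesTwosChains (suc n) = sym (over-1 n)

length-chainList : ∀ j → length ∘ chainList j ≐ chains j
length-chainList zero n = trans (length-++ (onesTwosChains n)) (cong₂ _+_ (length-onesTwosChains n)
  (trans (length-map _ (shift [] 2 onesTwosChains n)) (trans (shift-hom length [] 2 onesTwosChains n) (shift-cong 0 2 length-onesTwosChains n))))
length-chainList (suc j) n = trans (length-stepList _ _ (3 + j) (chainList j) n) (step-cong (2 + j) (length-chainList j) n)

overs-1 : ∀ n → overs 1 (suc n) ≡ ones (suc n) ∷ onesOverlined n ∷ []
overs-1 n = cong₂ (λ xs ys → xs ++ map ((1 , true) ∷_) ys) (geo-ones (suc n)) (geo-ones n)
  where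
  geo-ones : ∀ n → geoList ((1 , false) ∷_) 1 (overs 0) n ≡ ones n ∷ []
  geo-ones zero = refl
  geo-ones (suc n) = trans (geoList-eq ((1 , false) ∷_) 0 (overs 0) (suc n)) (cong (map ((1 , false) ∷_)) (geo-ones n))

concat-onesTwosChains : ∀ n → concat (onesTwosChains n) ↭ geoList ((2 , false) ∷_) 2 (overs 1) n
concat-onesTwosChains 0 = ↭-refl
concat-onesTwosChains 1 = ↭-refl
concat-onesTwosChains (suc (suc k)) = begin
  concat (onesTwosChains (2 + k))                                     ↭⟨ rearrange k ⟩
  ones (2 + k) ∷ onesOverlined (1 + k) ∷ map g (concat (onesTwosChains k)) ↭⟨ prep _ (prep _ (↭.map⁺ g (concat-onesTwosChains k))) ⟩
  ones (2 + k) ∷ onesOverlined (1 + k) ∷ map g (geoList g 2 (overs 1) k)   ≡⟨ cong (_++ map g (geoList g 2 (overs 1) k)) (sym (overs-1 (1 + k))) ⟩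
  overs 1 (2 + k) ++ map g (geoList g 2 (overs 1) k)                  ≡⟨ sym (geoList-eq g 1 (overs 1) (2 + k)) ⟩
  geoList g 2 (overs 1) (2 + k)                                       ∎
  where
  open PermutationReasoning
  g : List Entry → List Entry
  g = (2 , false) ∷_
  -- The heads of the chains are the members free of non-overlined 2, and the tails are the chains
  -- of weight k with a 2 in front. At k = 0 the chain with overlined 1 has an empty tail.
  rearrange : ∀ k → concat (onesTwosChains (2 + k)) ↭ ones (2 + k) ∷ onesOverlined (1 + k) ∷ map g (concat (onesTwosChains k))
  rearrange zero = prep _ (swap _ _ ↭-refl)
  rearrange (suc k) = prep _ (begin
    map g (chain ones (suc k)) ++ (onesOverlined (2 + k) ∷ map g (chain onesOverlined k) ++ [])
      ↭⟨ ↭.shift (onesOverlined (2 + k)) (map g (chain ones (suc k))) _ ⟩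
    onesOverlined (2 + k) ∷ map g (chain ones (suc k)) ++ (map g (chain onesOverlined k) ++ [])
      ≡⟨ cong (λ xs → onesOverlined (2 + k) ∷ map g (chain ones (suc k)) ++ xs) (sym (map-++ g (chain onesOverlined k) [])) ⟩
    onesOverlined (2 + k) ∷ map g (chain ones (suc k)) ++ map g (chain onesOverlined k ++ [])
      ≡⟨ cong (onesOverlined (2 + k) ∷_) (sym (map-++ g (chain ones (suc k)) _)) ⟩
    onesOverlined (2 + k) ∷ map g (chain ones (suc k) ++ (chain onesOverlined k ++ [])) ∎)

concat-chainList : ∀ j n → concat (chainList j n) ↭ overs (2 + j) n
concat-chainList zero n = ↭-trans (↭-reflexive (sym (concat-++ (onesTwosChains n) _)))
  (↭.++⁺ (concat-onesTwosChains n) (↭-trans (↭-reflexive (concat-map (shift [] 2 onesTwosChains n)))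
    (↭.map⁺ ((2 , true) ∷_) (↭-trans (↭-reflexive (shift-hom concat [] 2 onesTwosChains n))
      (shift-rel _↭_ ↭-refl 1 n (λ k _ → concat-onesTwosChains k))))))
concat-chainList (suc j) n = ↭-trans (↭-reflexive (concat-stepList ((3 + j , false) ∷_) ((3 + j , true) ∷_) (3 + j) (chainList j) n))
  (stepList-↭ ((3 + j , false) ∷_) ((3 + j , true) ∷_) (2 + j) (concat-chainList j) n)

-- The chains whose members all have largest part 3 + j, split by whether its first copy is
-- overlined.
chainsWithPart : ℕ → ℕ → List (List (List Entry))
chainsWithPart j n = map (map ((3 + j , false) ∷_)) (shift [] (3 + j) G n) ++ map (map ((3 + j , true) ∷_)) (shift [] (3 + j) G n)
  where
  G = geoList (map ((3 + j , false) ∷_)) (3 + j) (chainList j)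

chainList-suc : ∀ j n → chainList (suc j) n ≡ chainList j n ++ chainsWithPart j n
chainList-suc j n = trans (cong (_++ map h (shift [] (3 + j) G n)) (geoList-eq g (2 + j) (chainList j) n)) (++-assoc (chainList j n) _ _)
  where
  g h : List (List Entry) → List (List Entry)
  g = map ((3 + j , false) ∷_)
  h = map ((3 + j , true) ∷_)
  G = geoList g (3 + j) (chainList j)

-- Without a part ≥ 3 the trades can change the largest part, so there the chains are cut into single overpartitions.
rankChains : ℕ → ℕ → List (List (List Entry))
rankChains zero n = map [_] (concat (chainList 0 n))
rankChains (suc j) n = rankChains j n ++ chainsWithPart j n

concat-rankChains : ∀ j n → concat (rankChains j n) ≡ concat (chainList j n)
concat-rankChains zero n = concat-map-[ concat (chainList 0 n) ]
concat-rankChains (suc j) n = begin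
  concat (rankChains j n ++ chainsWithPart j n)             ≡⟨ sym (concat-++ (rankChains j n) (chainsWithPart j n)) ⟩
  concat (rankChains j n) ++ concat (chainsWithPart j n)    ≡⟨ cong (_++ concat (chainsWithPart j n)) (concat-rankChains j n) ⟩
  concat (chainList j n) ++ concat (chainsWithPart j n)     ≡⟨ concat-++ (chainList j n) (chainsWithPart j n) ⟩
  concat (chainList j n ++ chainsWithPart j n)              ≡⟨ cong concat (sym (chainList-suc j n)) ⟩
  concat (chainList (suc j) n)                              ∎
  where open ≡-Reasoning

-- These become singleton chains; raising n by 2 adds at most 4 of them.
over-2-≤ : ∀ n → over 2 n ≤ 2 * n + 1
over-2-≤ 0 = ≤-refl
over-2-≤ 1 = ≤-trans (≤-reflexive (trans (step-eq 1 (over 1) 1) (trans (+-identityʳ _) (trans (+-identityʳ _) (over-1 0))))) (s≤s (s≤s z≤n))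
over-2-≤ (suc (suc n)) = begin
  over 2 (2 + n)                             ≡⟨ step-eq 1 (over 1) (2 + n) ⟩
  over 1 (2 + n) + over 1 n + over 2 n       ≤⟨ +-mono-≤ (+-mono-≤ (≤-reflexive (over-1 (suc n))) (over-1-≤ n)) (over-2-≤ n) ⟩
  4 + (2 * n + 1)                            ≡⟨ lemma n ⟩
  2 * (2 + n) + 1                            ∎
  where
  open ≤-Reasoning
  lemma : ∀ n → 4 + (2 * n + 1) ≡ 2 * (2 + n) + 1
  lemma = solve-∀
  over-1-≤ : ∀ n → over 1 n ≤ 2
  over-1-≤ zero = s≤s z≤n
  over-1-≤ (suc n) = ≤-reflexive (over-1 n)

length-rankChains : ∀ j n → length (rankChains j n) ≤ chains j n + (2 * n + 1)
length-rankChains j n = ≤-trans (go j) (≤-reflexive (cong (_+ (2 * n + 1)) (length-chainList j n)))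
  where
  go : ∀ j → length (rankChains j n) ≤ length (chainList j n) + (2 * n + 1)
  go zero = ≤-trans (≤-reflexive (trans (length-map [_] (concat (chainList 0 n))) (trans (↭.↭-length (concat-chainList 0 n)) (length-overs 2 n))))
    (≤-trans (over-2-≤ n) (m≤n+m (2 * n + 1) (length (chainList 0 n))))
  go (suc j) = begin
    length (rankChains j n ++ new)                      ≡⟨ length-++ (rankChains j n) ⟩
    length (rankChains j n) + length new                ≤⟨ +-monoˡ-≤ (length new) (go j) ⟩
    length (chainList j n) + (2 * n + 1) + length new   ≡⟨ lemma (length (chainList j n)) (2 * n + 1) (length new) ⟩
    length (chainList j n) + length new + (2 * n + 1)   ≡⟨ cong (_+ (2 * n + 1)) (trans (sym (length-++ (chainList j n))) (cong length (sym (chainList-suc j n)))) ⟩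
    length (chainList (suc j) n) + (2 * n + 1)          ∎
    where
    open ≤-Reasoning
    new = chainsWithPart j n
    lemma : ∀ a b c → a + b + c ≡ a + c + b
    lemma = solve-∀

Trades : ℕ → List (List Entry) → Set
Trades m ch = Linked (λ λs μs → length λs ≡ suc (length μs)) ch × All (All (λ e → proj₁ e ≤ m)) ch

trades-cons : ∀ {m ch} b → Trades m ch → Trades m (map ((m , b) ∷_) ch)
trades-cons b (l , bd) = Linked.map⁺ (Linked.map (cong suc) l) , All.map⁺ (All.map (≤-refl ∷_) bd)

trades-suc : ∀ {m ch} → Trades m ch → Trades (suc m) ch
trades-suc (l , bd) = l , All.map (All.map m≤n⇒m≤1+n) bd

trades-chain : ∀ t → (∀ k → length (t (suc k)) ≡ suc (length (t k))) → (∀ k → All (λ e → proj₁ e ≤ 2) (t k)) → ∀ k → Trades 2 (chain t k)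
trades-chain t len bd 0 = [-] , bd 0 ∷ []
trades-chain t len bd 1 = [-] , bd 1 ∷ []
trades-chain t len bd (suc (suc k)) with trades-cons false (trades-chain t len bd k)
... | l , bds = trans (len (suc k)) (cong suc (len k)) ∷ l , bd (2 + k) ∷ bds

ones-bounded : ∀ k → All (λ e → proj₁ e ≤ 2) (ones k)
ones-bounded k = All.replicate⁺ k (s≤s z≤n)

trades-onesTwosChains : ∀ n → All (Trades 2) (onesTwosChains n)
trades-onesTwosChains zero = trades-chain ones (λ _ → refl) ones-bounded 0 ∷ []
trades-onesTwosChains (suc n) = trades-chain ones (λ _ → refl) ones-bounded (suc n) ∷
  trades-chain onesOverlined (λ _ → refl) (λ k → s≤s z≤n ∷ ones-bounded k) n ∷ []

trades-map-shift : ∀ m b (L : ℕ → List (List (List Entry))) → (∀ n → All (Trades m) (L n)) →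
  ∀ s n → All (Trades m) (map (map ((m , b) ∷_)) (shift [] s L n))
trades-map-shift m b L tr s n = All.map⁺ (All.map (trades-cons b)
  (shift-rel₀ {B = ℕ} (λ xs _ → All (Trades m) xs) {y = 0} [] s {g = id} n (λ k _ → tr k)))

trades-chainList : ∀ j n → All (Trades (2 + j)) (chainList j n)
trades-geoChainList : ∀ j n → All (Trades (3 + j)) (geoList (map ((3 + j , false) ∷_)) (3 + j) (chainList j) n)
trades-chainList zero n = All.++⁺ (trades-onesTwosChains n) (trades-map-shift 2 true onesTwosChains trades-onesTwosChains 2 n)
trades-chainList (suc j) n = All.++⁺ (trades-geoChainList j n) (trades-map-shift (3 + j) true _ (trades-geoChainList j) (3 + j) n)
trades-geoChainList j n = All.tabulate (geoList-ind (map ((3 + j , false) ∷_)) (2 + j) (chainList j) (λ _ → Trades (3 + j))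
  (λ n x x∈ → trades-suc (All.lookup (trades-chainList j n) x∈)) (λ _ _ → trades-cons false) n)

rank-cons : ∀ {m b λs} → All (λ e → proj₁ e ≤ m) λs → rank ((m , b) ∷ λs) ≡ ℤ.+ m ℤ.- ℤ.+ suc (length λs)
rank-cons {m} {b} {λs} bd = cong (λ x → ℤ.+ x ℤ.- ℤ.+ suc (length λs)) (m≥n⇒m⊔n≡m (largest-≤ bd))
  where
  largest-≤ : ∀ {λs} → All (λ e → proj₁ e ≤ m) λs → largestPart λs ≤ m
  largest-≤ [] = z≤n
  largest-≤ (p ∷ ps) = ⊔-lub p (largest-≤ ps)

-- With m in front, every member has largest part m, and a loss of one part is a gain of one in
-- rank.
nextRank-cons : ∀ {m ch} b → Trades m ch → Linked NextRank (map ((m , b) ∷_) ch)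
nextRank-cons b ([] , _) = []
nextRank-cons b ([-] , _) = [-]
nextRank-cons {m} b (_∷_ {λs} {μs} len l , bd ∷ bd′ ∷ bds) = next ∷ nextRank-cons b (l , bd′ ∷ bds)
  where
  lemma : ∀ m k → m ℤ.- (1ℤ ℤ.+ k) ≡ 1ℤ ℤ.+ (m ℤ.- (1ℤ ℤ.+ (1ℤ ℤ.+ k)))
  lemma = ℤSolver.solve-∀
  next : NextRank ((m , b) ∷ λs) ((m , b) ∷ μs)
  next = trans (rank-cons {m} {b} bd′) (trans (lemma (ℤ.+ m) (ℤ.+ length μs))
    (cong (λ x → 1ℤ ℤ.+ x) (trans (cong (λ x → ℤ.+ m ℤ.- ℤ.+ suc x) (sym len)) (sym (rank-cons {m} {b} bd)))))

rankChains-nextRank : ∀ j n → All (Linked NextRank) (rankChains j n)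
rankChains-nextRank zero n = All.map⁺ (All.universal (λ _ → [-]) (concat (chainList 0 n)))
rankChains-nextRank (suc j) n = All.++⁺ (rankChains-nextRank j n) (All.++⁺ (new false) (new true))
  where
  new : ∀ b → All (Linked NextRank) (map (map ((3 + j , b) ∷_)) (shift [] (3 + j) (geoList (map ((3 + j , false) ∷_)) (3 + j) (chainList j)) n))
  new b = All.map⁺ (All.map (nextRank-cons b)
    (shift-rel₀ {B = ℕ} (λ xs _ → All (Trades (3 + j)) xs) {y = 0} [] (3 + j) {g = id} n (λ k _ → trades-geoChainList j k)))

rank-equidistribution : ∀ a c′ n → let c = suc c′; r = length (rankChains n n) in
  c * Nbar a c n ≤ p̄ n + c′ * r × p̄ n ≤ c * Nbar a c n + c′ * r
rank-equidistribution a c′ n = subst₂ (λ x y → suc c′ * x ≤ y + c′ * length (rankChains n n) × y ≤ suc c′ * x + c′ * length (rankChains n n))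
  count-eq length-eq (rankCount-concat a c′ (rankChains n n) (rankChains-nextRank n n))
  where
  perm : concat (rankChains n n) ↭ overs (2 + n) n
  perm = ↭-trans (↭-reflexive (concat-rankChains n n)) (concat-chainList n n)
  count-eq : rankCount a (suc c′) (concat (rankChains n n)) ≡ Nbar a (suc c′) n
  count-eq = trans (↭.↭-length (↭.filter-↭ (rankCong? a (suc c′)) perm)) (sym (Nbar-overs a (suc c′) (m≤n+m n 2)))
  length-eq : length (concat (rankChains n n)) ≡ p̄ n
  length-eq = trans (↭.↭-length perm) (trans (length-overs (2 + n) n) (over-stable (2 + n) n (m≤n+m n 2)))

pbar≡p̄ : ∀ n → pbar n ≡ p̄ n
pbar≡p̄ n = trans (pbar-overs {n} {n} ≤-refl) (length-overs n n)

-- The inequalities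

p̄-≥1 : ∀ n → 1 ≤ p̄ n
p̄-≥1 zero = s≤s z≤n
p̄-≥1 (suc n) = ≤-trans (p̄-≥1 n) (p̄-monotone n)

partialSum-> : ∀ f → (∀ n → 1 ≤ f n) → ∀ n → n < partialSum f n
partialSum-> f pos zero = pos 0
partialSum-> f pos (suc n) = +-mono-≤ (pos (suc n)) (partialSum-> f pos n)

-- This makes the 2n + 1 singleton chains cost at most 0.001 f(n). S is at least 123 as a sum of 123
-- positive values, and `Growth` then gives even 2000 (n + 2) ≤ f(n).
growth-linear : ∀ f S n → 123 ≤ S → 270 ≤ n → Growth S f n → (2 * n + 1) * 1000 ≤ f n
growth-linear f S n S≥ n≥ = core (2 * n + 1) (2 + n) (3 + n) (f n)
  (≤-trans (+-monoʳ-≤ (2 * n) (s≤s z≤n)) (≤-reflexive (lemma n))) (+-monoʳ-≤ 3 n≥)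
  where
  open ≤-Reasoning
  lemma : ∀ n → 2 * n + 4 ≡ (2 + n) * 2
  lemma = solve-∀
  lemma′ : ∀ a b c → a * (b * c) ≡ b * (a * c)
  lemma′ = solve-∀
  core : ∀ w m t x → w ≤ m * 2 → 273 ≤ t → S * 764 * (m * t) ≤ x * 2000 → w * 1000 ≤ x
  core w m t x w≤ t≥ g = *-cancelʳ-≤ (w * 1000) x 2000 (begin
    w * 1000 * 2000            ≡⟨ *-assoc w 1000 2000 ⟩
    w * 2000000                ≤⟨ *-monoˡ-≤ 2000000 w≤ ⟩
    m * 2 * 2000000            ≡⟨ *-assoc m 2 2000000 ⟩
    m * 4000000                ≤⟨ *-monoʳ-≤ m (≤-trans (≤ᵇ⇒≤ 4000000 (123 * 764 * 273) _) (*-mono-≤ (*-monoˡ-≤ 764 S≥) t≥)) ⟩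
    m * (S * 764 * t)          ≡⟨ lemma′ m (S * 764) t ⟩
    S * 764 * (m * t)          ≤⟨ g ⟩
    x * 2000                   ∎)

slow-at : ∀ f → Monotone f → LogDerivσ f → f 0 ≡ 1 → ∀ n d → 272 + d ≡ n → f n * 764 ≤ sh 2 f n * 1000
slow-at f mono L f0 n d e = subst (λ n → f n * 764 ≤ sh 2 f n * 1000) e
  (proj₁ (eventually-slow f mono L f0 (1 + d)) (270 + d) (+-mono-≤ (≤ᵇ⇒≤ 123 272 _) (z≤n {d})) (s≤s (≤-reflexive (+-comm 270 d))))

growth-at : ∀ f → Monotone f → LogDerivσ f → f 0 ≡ 1 → ∀ n d → 272 + d ≡ n → Growth (partialSum f 122) f n
growth-at f mono L f0 n d e =
  subst (Growth (partialSum f 122) f) (trans (+-comm (2 + d) 270) (trans (sym (+-assoc 270 2 d)) e)) (proj₂ (eventually-slow f mono L f0 (2 + d)))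

slow-and-large : ∀ f → Monotone f → LogDerivσ f → f 0 ≡ 1 → (∀ n → 1 ≤ f n) →
  ∀ n → 272 ≤ n → f n * 764 ≤ sh 2 f n * 1000 × (2 * n + 1) * 1000 ≤ f n
slow-and-large f mono L f0 pos n n≥ = slow-at f mono L f0 n d e ,
  growth-linear f (partialSum f 122) n (partialSum-> f pos 122) (≤-trans (≤ᵇ⇒≤ 270 272 _) n≥) (growth-at f mono L f0 n d e)
  where
  d = proj₁ (m≤n⇒∃[o]m+o≡n n≥)
  e = proj₂ (m≤n⇒∃[o]m+o≡n n≥)

-- The 0.237 is 1 - 0.764 for the chains proper plus 0.001 for the singletons.
rankChains-few : ∀ n → 272 ≤ n → length (rankChains n n) * 1000 ≤ p̄ n * 237
rankChains-few n n≥ = combine (length (rankChains n n)) (chains n n) (2 * n + 1) (p̄ n) (sh 2 p̄ n)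
  (length-rankChains n n) (p̄-chains n) (proj₁ facts) (proj₂ facts)
  where
  open ≤-Reasoning
  facts = slow-and-large p̄ p̄-monotone p̄-logDeriv refl p̄-≥1 n n≥
  combine : ∀ r x w p q → r ≤ x + w → p ≡ x + q → p * 764 ≤ q * 1000 → w * 1000 ≤ p → r * 1000 ≤ p * 237
  combine r x w p q r≤ e slow w≤ = +-cancelʳ-≤ (q * 1000) (r * 1000) (p * 237) (begin
    r * 1000 + q * 1000               ≤⟨ +-monoˡ-≤ (q * 1000) (*-monoˡ-≤ 1000 r≤) ⟩
    (x + w) * 1000 + q * 1000         ≡⟨ lemma x w q 1000 ⟩
    (x + q) * 1000 + w * 1000         ≤⟨ +-mono-≤ (≤-reflexive (cong (_* 1000) (sym e))) w≤ ⟩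
    p * 1000 + p                      ≡⟨ lemma′ p ⟩
    p * 237 + p * 764                 ≤⟨ +-monoʳ-≤ (p * 237) slow ⟩
    p * 237 + q * 1000                ∎)
    where
    lemma : ∀ x w q k → (x + w) * k + q * k ≡ (x + q) * k + w * k
    lemma = solve-∀
    lemma′ : ∀ p → p * 1000 + p ≡ p * 237 + p * 764
    lemma′ p = trans (cong (p * 1000 +_) (sym (*-identityʳ p)))
      (trans (sym (*-distribˡ-+ p 1000 1)) (*-distribˡ-+ p 237 764))

-- K is a common denominator: the number of chains is at most γ/K of p, and the last two hypotheses
-- say that c - 1 times this error still fits between the bounds α/K and β/K.
few-chains-bounds : ∀ c′ K γ α β N p r → let c = suc c′ in 1 ≤ p →
  c * N ≤ p + c′ * r → p ≤ c * N + c′ * r → r * K ≤ p * γ → c * α + c′ * γ < K → K + c′ * γ < c * β →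
  α * p < K * N × K * N < β * p
few-chains-bounds c′ K γ α β N p r p≥1 up lo r≤ h-lo h-up = lower , upper
  where
  open ≤-Reasoning
  c = suc c′
  instance _ = >-nonZero p≥1
  lemma₁ : ∀ c c′ K N r → K * (c * N + c′ * r) ≡ c * (K * N) + c′ * (r * K)
  lemma₁ = solve-∀
  lemma₂ : ∀ c c′ α γ p → c * (α * p) + c′ * (p * γ) ≡ (c * α + c′ * γ) * p
  lemma₂ = solve-∀
  lemma₃ : ∀ c K N → c * (K * N) ≡ K * (c * N)
  lemma₃ = solve-∀
  lemma₄ : ∀ K p c′ r → K * (p + c′ * r) ≡ K * p + c′ * (r * K)
  lemma₄ = solve-∀
  lemma₅ : ∀ K c′ p γ → K * p + c′ * (p * γ) ≡ (K + c′ * γ) * p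
  lemma₅ = solve-∀
  lower : α * p < K * N
  lower = *-cancelˡ-< c (α * p) (K * N) (+-cancelʳ-< (c′ * (p * γ)) (c * (α * p)) (c * (K * N)) (begin-strict
    c * (α * p) + c′ * (p * γ)      ≡⟨ lemma₂ c c′ α γ p ⟩
    (c * α + c′ * γ) * p            <⟨ *-monoˡ-< p h-lo ⟩
    K * p                           ≤⟨ *-monoʳ-≤ K lo ⟩
    K * (c * N + c′ * r)            ≡⟨ lemma₁ c c′ K N r ⟩
    c * (K * N) + c′ * (r * K)      ≤⟨ +-monoʳ-≤ (c * (K * N)) (*-monoʳ-≤ c′ r≤) ⟩
    c * (K * N) + c′ * (p * γ)      ∎))
  upper : K * N < β * p
  upper = *-cancelˡ-< c (K * N) (β * p) (begin-strict
    c * (K * N)                     ≡⟨ lemma₃ c K N ⟩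
    K * (c * N)                     ≤⟨ *-monoʳ-≤ K up ⟩
    K * (p + c′ * r)                ≡⟨ lemma₄ K p c′ r ⟩
    K * p + c′ * (r * K)            ≤⟨ +-monoʳ-≤ (K * p) (*-monoʳ-≤ c′ r≤) ⟩
    K * p + c′ * (p * γ)            ≡⟨ lemma₅ K c′ p γ ⟩
    (K + c′ * γ) * p                <⟨ *-monoˡ-< p h-up ⟩
    c * β * p                       ≡⟨ *-assoc c β p ⟩
    c * (β * p)                     ∎)

small-modulus : ∀ c c′ α β → c ≡ suc c′ → c * α + c′ * 2370 < 10000 → 10000 + c′ * 2370 < c * β →
  ∀ a n → 272 ≤ n → α * pbar n < 10000 * Nbar a c n × 10000 * Nbar a c n < β * pbar n
small-modulus c c′ α β refl h-lo h-up a n n≥ = subst (λ p → α * p < 10000 * Nbar a (suc c′) n × 10000 * Nbar a (suc c′) n < β * p) (sym (pbar≡p̄ n))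
  (few-chains-bounds c′ 10000 2370 α β (Nbar a (suc c′) n) (p̄ n) r (p̄-≥1 n) (proj₁ eq) (proj₂ eq) scaled h-lo h-up)
  where
  r = length (rankChains n n)
  eq = rank-equidistribution a c′ n
  scaled : r * 10000 ≤ p̄ n * 2370
  scaled = subst₂ _≤_ (*-assoc r 1000 10) (*-assoc (p̄ n) 237 10) (*-monoˡ-≤ 10 (rankChains-few n n≥))

-- The total error (c - 1) r is below p/2, which is half of the expected value of c N.
large-modulus : ∀ c′ N p r → 2 * suc c′ * r < p → suc c′ * N ≤ p + c′ * r → p ≤ suc c′ * N + c′ * r →
  p < 2 * suc c′ * N × 2 * suc c′ * N < 3 * p
large-modulus c′ N p r h up lo = +-cancelʳ-< p p (2 * c * N) (begin-strict
    p + p                              ≤⟨ +-mono-≤ lo lo ⟩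
    c * N + c′ * r + (c * N + c′ * r)  ≡⟨ lemma c c′ N r ⟩
    2 * c * N + 2 * (c′ * r)           <⟨ +-monoʳ-< (2 * c * N) small ⟩
    2 * c * N + p                      ∎) , (begin-strict
    2 * c * N                          ≡⟨ *-assoc 2 c N ⟩
    2 * (c * N)                        ≤⟨ *-monoʳ-≤ 2 up ⟩
    2 * (p + c′ * r)                   ≡⟨ *-distribˡ-+ 2 p (c′ * r) ⟩
    2 * p + 2 * (c′ * r)               <⟨ +-monoʳ-< (2 * p) small ⟩
    2 * p + p                          ≡⟨ lemma′ p ⟩
    3 * p                              ∎)
  where
  open ≤-Reasoning
  c = suc c′
  lemma : ∀ c c′ N r → c * N + c′ * r + (c * N + c′ * r) ≡ 2 * c * N + 2 * (c′ * r)
  lemma = solve-∀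
  lemma′ : ∀ p → 2 * p + p ≡ 3 * p
  lemma′ = solve-∀
  small : 2 * (c′ * r) < p
  small = ≤-<-trans (≤-trans (*-monoʳ-≤ 2 (*-monoˡ-≤ r (n≤1+n c′))) (≤-reflexive (sym (*-assoc 2 c r)))) h

theorem3p1 : ((a : ℤ) (n : ℕ) → 2089 ≤ n →
    (19 * pbar n < 10000 * Nbar a 3 n) × (10000 * Nbar a 3 n < 6648 * pbar n))
    × ((a : ℤ) (n : ℕ) → 272 ≤ n →
    (91 * pbar n < 10000 * Nbar a 4 n) × (10000 * Nbar a 4 n < 4909 * pbar n))
    × ((a : ℤ) (n : ℕ) → 449 ≤ n →
    (103 * pbar n < 10000 * Nbar a 5 n) × (10000 * Nbar a 5 n < 3897 * pbar n))
    × ((c : ℕ) → 6 ≤ c → (a : ℤ) (n : ℕ) → AtLeastMc c n →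
    (pbar n < 2 * c * Nbar a c n) × (2 * c * Nbar a c n < 3 * pbar n))
theorem3p1 =
    (λ a n n≥ → small-modulus 3 2 19 6648 refl (<ᵇ⇒< _ _ _) (<ᵇ⇒< _ _ _) a n (≤-trans (≤ᵇ⇒≤ 272 2089 _) n≥))
  , small-modulus 4 3 91 4909 refl (<ᵇ⇒< _ _ _) (<ᵇ⇒< _ _ _)
  -- The tight case: 5 · 103 + 4 · 2370 = 9995 < 10000 and 10000 + 4 · 2370 = 19480 < 19485 = 5 ·
  -- 3897.
  , (λ a n n≥ → small-modulus 5 4 103 3897 refl (<ᵇ⇒< _ _ _) (<ᵇ⇒< _ _ _) a n (≤-trans (≤ᵇ⇒≤ 272 449 _) n≥))
  , large
  where
  large : (c : ℕ) → 6 ≤ c → (a : ℤ) (n : ℕ) → AtLeastMc c n → pbar n < 2 * c * Nbar a c n × 2 * c * Nbar a c n < 3 * pbar n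
  large c@(suc c′) 6≤c a n h = subst (λ p → p < 2 * c * Nbar a c n × 2 * c * Nbar a c n < 3 * p) (sym (pbar≡p̄ n))
    (large-modulus c′ (Nbar a c n) (p̄ n) (length (rankChains n n))
      (rank-error-small c n (length (rankChains n n)) 6≤c h (length-rankChains n n))
      (proj₁ (rank-equidistribution a c′ n)) (proj₂ (rank-equidistribution a c′ n)))
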